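{- Let $p$ be a prime, let $s$ be a positive integer, and let $M=p^s$. For any $i,j\in\mathbb{Z}$ satisfying $0\le j<i<M$, there exists $u(x)\in\mathbb{Z}[x]/\Phi_M(x)$ such that $(x^i-x^j)\cdot u(x)=p \pmod{\Phi_M(x)}$ and $\|u(x)\|_\infty\le p-1$.
   Context: $\Phi_M(x)$ denotes the $M$th cyclotomic polynomial, of degree $\phi(M)$ (Euler's totient). $\mathbb{Z}[x]/\Phi_M(x)$ is the quotient of $\mathbb{Z}[x]$ by the ideal generated by $\Phi_M(x)$. For $g\in\mathbb{Z}[x]/\Phi_M(x)$, $\|g\|_\infty$ is the largest absolute value of the coefficients of the unique representative of $g$ in $\mathbb{Z}[x]$ of degree less than $\phi(M)$. -}

module Defs where

open import Data.Bool.Base using (if_then_else_)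
open import Data.Integer.Base as ℤ using (ℤ; 0ℤ; 1ℤ; -1ℤ; ∣_∣)
import Data.Integer.Properties as ℤ
open import Data.List.Base using (List; []; _∷_; _++_; map; foldr; filter; replicate; take; upTo)
open import Data.List.Extrema.Nat using (max)
open import Data.List.Relation.Unary.All using (all?)
open import Data.Nat.Base using (ℕ; zero; suc)
open import Data.Nat.Divisibility using (_∣?_)
open import Data.Product.Base using (∃-syntax)
open import Relation.Binary.PropositionalEquality.Core using (_≡_)
open import Relation.Nullary.Decidable.Core using (does)

infix  4 _≈_ _≡_[mod_]
infixl 6 _+_ _-_
infixl 7 _*_ _·_ _quot_ _rem_
infixr 8 X^_

-- Coefficients are listed from the constant term upwards. Trailing zeros are
-- allowed, so polynomials are compared with _≈_ rather than _≡_.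
Poly : Set
Poly = List ℤ

coeff : Poly → ℕ → ℤ
coeff []      _       = 0ℤ
coeff (a ∷ f) zero    = a
coeff (a ∷ f) (suc k) = coeff f k

_≈_ : Poly → Poly → Set
f ≈ g = ∀ k → coeff f k ≡ coeff g k

const : ℤ → Poly
const a = a ∷ []

X^_ : ℕ → Poly
X^ n = replicate n 0ℤ ++ const 1ℤ

_+_ : Poly → Poly → Poly
[]      + g       = g
(a ∷ f) + []      = a ∷ f
(a ∷ f) + (b ∷ g) = a ℤ.+ b ∷ f + g

_·_ : ℤ → Poly → Poly
a · f = map (a ℤ.*_) f

_-_ : Poly → Poly → Poly
f - g = f + -1ℤ · g

_*_ : Poly → Poly → Poly
[]      * g = []
(a ∷ f) * g = a · g + (0ℤ ∷ f * g)

∏ : List Poly → Poly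
∏ = foldr _*_ (const 1ℤ)

-- The zero polynomial gets degree 0.
degree : Poly → ℕ
degree []      = 0
degree (a ∷ f) = if does (all? (ℤ._≟ 0ℤ) f) then 0 else suc (degree f)

-- Equality in the quotient ring ℤ[x]/(f), whose elements are represented by
-- arbitrary polynomials.
_≡_[mod_] : Poly → Poly → Poly → Set
g ≡ h [mod f ] = ∃[ q ] g - h ≈ q * f

-- Long division, meaningful for monic f:
--   g ≈ (g quot f) * f + (g rem f), where g rem f has only the terms of degree
--   less than deg f.
-- If g = q f + r, then a + x g = (c + x q) f + ((a + x r) - c f), where c is
-- the coefficient of a + x r in degree deg f.
reduce : Poly → Poly → Poly
reduce f h = take (degree f) (h - coeff h (degree f) · f)

_rem_ : Poly → Poly → Poly
[]      rem f = []
(a ∷ g) rem f = reduce f (a ∷ g rem f)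

_quot_ : Poly → Poly → Poly
[]      quot f = []
(a ∷ g) quot f = coeff (a ∷ g rem f) (degree f) ∷ g quot f

properDivisors : ℕ → List ℕ
properDivisors n = filter (_∣? n) (upTo n)

-- The cyclotomic polynomials are determined by ∏_{d ∣ n} Φ d = x^n - 1 for
-- n ≥ 1, that is, Φ n = (x^n - 1) / ∏_{d ∣ n, d < n} Φ d. The first argument
-- of cyclotomic bounds the recursion depth; any bound ≥ n gives Φ n.
cyclotomic : ℕ → ℕ → Poly
cyclotomic zero    _ = const 1ℤ
cyclotomic (suc b) n =
  (X^ n - X^ 0) quot ∏ (map (cyclotomic b) (properDivisors n))

Φ : ℕ → Poly
Φ n = cyclotomic n n

-- For M ≥ 1, Φ M is monic of degree φ(M), so u rem Φ M is the unique
-- representative of u in ℤ[x]/(Φ M) of degree less than φ(M).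
‖_‖∞[_] : Poly → ℕ → ℕ
‖ u ‖∞[ M ] = max 0 (map ∣_∣ (u rem Φ M))

{-# OPTIONS --safe #-}

-- Let q = p^(s-1) and M = p q, so that Φ_M = ∑_{k<p} x^(kq) and x^M = 1 modulo
-- Φ_M. Put d = i - j. In ℤ[x]/(x^M - 1) a sequence (c_r) of period M represents
-- ∑ c_r x^r, multiplication by x shifts it cyclically, and the sequences of
-- period q span the multiples of Φ_M. Hence x^d - 1 divides p modulo Φ_M as soon
-- as c_r - c_{d+r} = p ⟦M ∣ d+r⟧ - ⟦q ∣ d+r⟧ for some c. Such a c is found by
-- walking along the subgroup generated by d in ℤ/M: as gcd(d, M) divides q, it is
-- r ↦ ⌊(r a mod M) / q⌋ there, with a d ≡ gcd(d, M) mod M, and 0 elsewhere.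
-- Its values lie in [0, p - 1]. Subtracting from c_r the value of c at the index
-- congruent to r mod q in [M - q, M) clears the degrees ≥ M - q = φ(M) and leaves
-- differences of two elements of [0, p - 1].
module Submission where

open import Algebra.Bundles using (CommutativeRing; CommutativeSemigroup)
import Algebra.Properties.AbelianGroup as AbelianGroupProperties
import Algebra.Properties.CommutativeSemigroup as CommutativeSemigroupProperties
import Algebra.Properties.Ring as RingProperties
import Algebra.Solver.Ring.NaturalCoefficients.Default as SemiringSolver
open import Data.Bool.Base using (if_then_else_)
open import Data.Integer.Base as ℤ using (ℤ; 0ℤ; 1ℤ; -1ℤ; +_; ∣_∣)
import Data.Integer.Properties as ℤ
open import Data.List.Base using ([]; _∷_; [_]; _++_; _∷ʳ_; applyUpTo; filter; map; take; upTo)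
open import Data.List.Extrema.Nat using (max; max≤v⁺)
open import Data.List.Properties using (upTo-∷ʳ; filter-++; filter-accept; filter-reject; ++-identityʳ; map-++)
open import Data.List.Relation.Unary.All using (All; []; _∷_; all?)
open import Data.Nat.Base as ℕ
  using (ℕ; zero; suc; _≤_; _<_; _^_; _∸_; _%_; _/_; z≤n; s≤s; NonZero)
open import Data.Nat.Coprimality using (Coprime; coprime-divisor)
open import Data.Nat.Divisibility using
  ( _∣_; divides; divides-refl; quotient; _∣?_; ∣-refl; ∣-trans; ∣⇒≤; _∣0; 0∣⇒≡0; ∣1⇒≡1; n∣m*n
  ; ∣m⇒∣m*n; ∣n⇒∣m*n; ∣m∣n⇒∣m+n; ∣m+n∣m⇒∣n; %-presˡ-∣; ∣n∣m%n⇒∣m)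
open import Data.Nat.DivMod using
  ( m≡m%n+[m/n]*n; [m+kn]%n≡m%n; [m+n]%n≡m%n; m%n<n; m<n⇒m%n≡m; n%n≡0; %-distribˡ-+
  ; +-distrib-/-∣ʳ; m*n/n≡m; m<n⇒m/n≡0; m<n*o⇒m/o<n; 0/n≡0)
open import Data.Nat.GCD using (gcd; gcd-GCD; gcd[m,n]∣m; gcd[m,n]∣n; module Bézout)
open import Data.Nat.Primality using (Prime; prime⇒irreducible; prime⇒nonZero; prime⇒nonTrivial)
import Data.Nat.Properties as ℕ
open import Data.Nat.Tactic.RingSolver using (solve-∀)
open import Data.Product.Base using (_×_; _,_; proj₁; proj₂; ∃-syntax)
open import Data.Sum.Base using (_⊎_; inj₁; inj₂)
open import Function.Bundles using (_⇔_; mk⇔; Equivalence)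
open import Level using (0ℓ; _⊔_)
open import Relation.Binary.Bundles using (Setoid)
import Relation.Binary.PropositionalEquality as ≡
open ≡ using (_≡_; _≢_)
import Relation.Binary.Reasoning.Setoid as SetoidReasoning
open import Relation.Nullary using (¬_; yes; no; does; contradiction)
open import Relation.Nullary.Decidable using (dec-true; dec-false; does-⇔)
open import Relation.Unary using (Pred; Decidable)

-- Depending on the raw operations only, sums in a ring and in a quotient of it
-- are definitionally equal.
module RawSum {a} {A : Set a} (_+_ : A → A → A) (0# : A) where

  ∑ : ℕ → (ℕ → A) → A
  ∑ zero    F = 0#
  ∑ (suc n) F = ∑ n F + F n

-- Finite sums, geometric sums and periodic coefficient sequences in a commutative ring.

module Sums {a ℓ} (R : CommutativeRing a ℓ) where
  open CommutativeRing R
  open RingProperties ring using ([y-z]x≈yx-zx)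
  open AbelianGroupProperties +-abelianGroup using (xyx⁻¹≈y; ∙-cancelˡ; ∙-cancelʳ)
  open SetoidReasoning setoid
  open SemiringSolver commutativeSemiring using (solve; _:+_; _:*_; _:=_)

  open RawSum _+_ 0# public

  ∑-cong : ∀ n {F G} → (∀ r → r < n → F r ≈ G r) → ∑ n F ≈ ∑ n G
  ∑-cong zero    F≈G = refl
  ∑-cong (suc n) F≈G =
    +-cong (∑-cong n λ r r<n → F≈G r (ℕ.m<n⇒m<1+n r<n)) (F≈G n (ℕ.n<1+n n))

  ∑-zero : ∀ n {F} → (∀ r → r < n → F r ≈ 0#) → ∑ n F ≈ 0#
  ∑-zero zero    F≈0 = refl
  ∑-zero (suc n) F≈0 = trans
    (+-cong (∑-zero n λ r r<n → F≈0 r (ℕ.m<n⇒m<1+n r<n)) (F≈0 n (ℕ.n<1+n n)))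
    (+-identityʳ 0#)

  ∑-+ : ∀ n {F G} → ∑ n (λ r → F r + G r) ≈ ∑ n F + ∑ n G
  ∑-+ zero            = sym (+-identityʳ 0#)
  ∑-+ (suc n) {F} {G} = trans (+-congʳ (∑-+ n))
    (solve 4 (λ u v w x → ((u :+ v) :+ (w :+ x)) := ((u :+ w) :+ (v :+ x))) refl
      (∑ n F) (∑ n G) (F n) (G n))

  *-∑ : ∀ n {F} x → x * ∑ n F ≈ ∑ n (λ r → x * F r)
  *-∑ zero    x = zeroʳ x
  *-∑ (suc n) x = trans (distribˡ x _ _) (+-congʳ (*-∑ n x))

  ∑-split : ∀ m n {F} → ∑ (m ℕ.+ n) F ≈ ∑ m F + ∑ n (λ r → F (m ℕ.+ r))
  ∑-split m zero    rewrite ℕ.+-identityʳ m = sym (+-identityʳ _)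
  ∑-split m (suc n) rewrite ℕ.+-suc m n = trans (+-congʳ (∑-split m n)) (+-assoc _ _ _)

  ∑-suc : ∀ n {F} → ∑ (suc n) F ≈ F 0 + ∑ n (λ r → F (suc r))
  ∑-suc n = trans (∑-split 1 n) (+-congʳ (+-identityˡ _))

  ∑-head : ∀ n {F} → 0 < n → (∀ r → 0 < r → r < n → F r ≈ 0#) → ∑ n F ≈ F 0
  ∑-head (suc n) {F} _ F≈0 = begin
    ∑ (suc n) F                  ≈⟨ ∑-suc n ⟩
    F 0 + ∑ n (λ r → F (suc r))  ≈⟨ +-congˡ (∑-zero n λ r r<n → F≈0 (suc r) (s≤s z≤n) (s≤s r<n)) ⟩
    F 0 + 0#                     ≈⟨ +-identityʳ _ ⟩
    F 0                          ∎

  -- A single shift trades `F 0` for `F n`, equal by periodicity; cancelling `F 0` gives the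
  -- induction step on `d`.
  ∑-shift : ∀ n d {F} → (∀ r → F (n ℕ.+ r) ≈ F r) → ∑ n (λ r → F (d ℕ.+ r)) ≈ ∑ n F
  ∑-shift n zero        per = refl
  ∑-shift n (suc d) {F} per = trans (∑-shift n d per′) (∙-cancelˡ (F 0) _ _ (begin
    F 0 + ∑ n (λ r → F (suc r))  ≈⟨ ∑-suc n ⟨
    ∑ n F + F n                  ≈⟨ +-comm _ _ ⟩
    F n + ∑ n F                  ≡⟨ ≡.cong (λ k → F k + ∑ n F) (ℕ.+-identityʳ n) ⟨
    F (n ℕ.+ 0) + ∑ n F          ≈⟨ +-congʳ (per 0) ⟩
    F 0 + ∑ n F                  ∎))
    where
    per′ : ∀ r → F (suc (n ℕ.+ r)) ≈ F (suc r)
    per′ r = trans (reflexive (≡.cong F (≡.sym (ℕ.+-suc n r)))) (per (suc r))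

  -- `pow` is abstract so that `X^_` can be used both in ℤ[x], where Φ is computed, and in the
  -- quotient by Φ.
  module Powers (pow : ℕ → Carrier) (pow-0 : pow 0 ≈ 1#)
                (pow-+ : ∀ m n → pow (m ℕ.+ n) ≈ pow m * pow n) where

    -- Telescoping. It serves both to factor x^(nq) - 1 and to show x^(nq) = 1 wherever the
    -- geometric sum vanishes.
    geometric : ∀ q n → (pow q - pow 0) * ∑ n (λ k → pow (k ℕ.* q)) ≈ pow (n ℕ.* q) - pow 0
    geometric q zero    = trans (zeroʳ _) (sym (-‿inverseʳ _))
    geometric q (suc n) = begin
      (pow q - pow 0) * (∑ n _ + pow (n ℕ.* q))
        ≈⟨ distribˡ _ _ _ ⟩
      (pow q - pow 0) * ∑ n _ + (pow q - pow 0) * pow (n ℕ.* q)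
        ≈⟨ +-cong (geometric q n) ([y-z]x≈yx-zx _ _ _) ⟩
      (pow (n ℕ.* q) - pow 0) + (pow q * pow (n ℕ.* q) - pow 0 * pow (n ℕ.* q))
        ≈⟨ +-congˡ (+-cong (pow-+ q (n ℕ.* q)) (-‿cong (pow-+ 0 (n ℕ.* q)))) ⟨
      (pow (n ℕ.* q) - pow 0) + (pow (q ℕ.+ n ℕ.* q) - pow (n ℕ.* q))
        ≈⟨ solve 4 (λ u v w x → ((u :+ v) :+ (w :+ x)) := ((u :+ x) :+ (w :+ v))) refl _ _ _ _ ⟩
      (pow (n ℕ.* q) - pow (n ℕ.* q)) + (pow (q ℕ.+ n ℕ.* q) - pow 0)
        ≈⟨ trans (+-congʳ (-‿inverseʳ _)) (+-identityˡ _) ⟩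
      pow (q ℕ.+ n ℕ.* q) - pow 0 ∎

    ∑pow : ℕ → (ℕ → Carrier) → Carrier
    ∑pow n w = ∑ n (λ r → w r * pow r)

    pow*∑pow : ∀ d N c → pow d * ∑pow N c ≈ ∑ N (λ r → c r * pow (d ℕ.+ r))
    pow*∑pow d N c = trans (*-∑ N (pow d)) (∑-cong N λ r _ → begin
      pow d * (c r * pow r)  ≈⟨ solve 3 (λ x y z → (x :* (y :* z)) := (y :* (x :* z))) refl _ _ _ ⟩
      c r * (pow d * pow r)  ≈⟨ *-congˡ (pow-+ d r) ⟨
      c r * pow (d ℕ.+ r)    ∎)

    -- Successive blocks of `q` terms differ by the factor `pow q`, so the first block factors out
    -- and leaves a geometric sum. This is why `q`-periodic sequences represent multiples of Φ.
    ∑pow-periodic : ∀ q n {w} → (∀ r → w (q ℕ.+ r) ≈ w r) →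
      ∑pow (n ℕ.* q) w ≈ ∑ n (λ k → pow (k ℕ.* q)) * ∑pow q w
    ∑pow-periodic q zero        per = sym (zeroˡ _)
    ∑pow-periodic q (suc n) {w} per = begin
      ∑pow (q ℕ.+ n ℕ.* q) w
        ≈⟨ ∑-split q (n ℕ.* q) ⟩
      ∑pow q w + ∑ (n ℕ.* q) (λ r → w (q ℕ.+ r) * pow (q ℕ.+ r))
        ≈⟨ +-congˡ (∑-cong (n ℕ.* q) λ r _ → trans (*-cong (per r) (pow-+ q r))
             (solve 3 (λ x y z → (x :* (y :* z)) := (y :* (x :* z))) refl _ _ _)) ⟩
      ∑pow q w + ∑ (n ℕ.* q) (λ r → pow q * (w r * pow r))
        ≈⟨ +-congˡ (*-∑ (n ℕ.* q) (pow q)) ⟨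
      ∑pow q w + pow q * ∑pow (n ℕ.* q) w
        ≈⟨ +-cong (sym (trans (*-congʳ pow-0) (*-identityˡ _))) (*-congˡ (∑pow-periodic q n per)) ⟩
      pow 0 * ∑pow q w + pow q * (∑ n (λ k → pow (k ℕ.* q)) * ∑pow q w)
        ≈⟨ solve 4 (λ x y z t → (x :* t :+ y :* (z :* t)) := ((x :+ y :* z) :* t)) refl _ _ _ _ ⟩
      (pow 0 + pow q * ∑ n (λ k → pow (k ℕ.* q))) * ∑pow q w
        ≈⟨ *-congʳ (+-congˡ (trans (*-∑ n (pow q)) (∑-cong n λ k _ → sym (pow-+ q (k ℕ.* q))))) ⟩
      (pow 0 + ∑ n (λ k → pow (suc k ℕ.* q))) * ∑pow q w
        ≈⟨ *-congʳ (∑-suc n) ⟨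
      ∑ (suc n) (λ k → pow (k ℕ.* q)) * ∑pow q w ∎

    periodic-* : ∀ q n {w : ℕ → Carrier} → (∀ r → w (q ℕ.+ r) ≈ w r) →
      ∀ r → w (n ℕ.* q ℕ.+ r) ≈ w r
    periodic-* q zero        per r = refl
    periodic-* q (suc n) {w} per r = begin
      w (q ℕ.+ n ℕ.* q ℕ.+ r)    ≡⟨ ≡.cong w (ℕ.+-assoc q (n ℕ.* q) r) ⟩
      w (q ℕ.+ (n ℕ.* q ℕ.+ r))  ≈⟨ per _ ⟩
      w (n ℕ.* q ℕ.+ r)          ≈⟨ periodic-* q n per r ⟩
      w r                        ∎

    module Root (q n : ℕ) (root : ∑ n (λ k → pow (k ℕ.* q)) ≈ 0#) where

      ∑pow-vanishes : ∀ {w} → (∀ r → w (q ℕ.+ r) ≈ w r) → ∑pow (n ℕ.* q) w ≈ 0#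
      ∑pow-vanishes per = trans (∑pow-periodic q n per) (trans (*-congʳ root) (zeroˡ _))

      -- By `geometric`, x^(nq) - 1 is a multiple of the sum that `root` makes zero.
      pow-periodic : ∀ r → pow (n ℕ.* q ℕ.+ r) ≈ pow r
      pow-periodic r = begin
        pow (n ℕ.* q ℕ.+ r)      ≈⟨ pow-+ (n ℕ.* q) r ⟩
        pow (n ℕ.* q) * pow r    ≈⟨ *-congʳ (∙-cancelʳ (- pow 0) _ _ (begin
          pow (n ℕ.* q) - pow 0                          ≈⟨ geometric q n ⟨
          (pow q - pow 0) * ∑ n (λ k → pow (k ℕ.* q))    ≈⟨ trans (*-congˡ root) (zeroʳ _) ⟩
          0#                                             ≈⟨ -‿inverseʳ _ ⟨
          pow 0 - pow 0                                  ∎)) ⟩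
        pow 0 * pow r            ≈⟨ pow-+ 0 r ⟨
        pow r                    ∎

      ∑pow-rotate : ∀ d {c : ℕ → Carrier} → (∀ r → c (n ℕ.* q ℕ.+ r) ≈ c r) →
        ∑ (n ℕ.* q) (λ r → c (d ℕ.+ r) * pow (d ℕ.+ r)) ≈ ∑pow (n ℕ.* q) c
      ∑pow-rotate d {c} per = ∑-shift (n ℕ.* q) d {λ r → c r * pow r} λ r → *-cong (per r) (pow-periodic r)

      ∑pow-shift : ∀ d {c : ℕ → Carrier} → (∀ r → c (n ℕ.* q ℕ.+ r) ≈ c r) →
        pow d * ∑pow (n ℕ.* q) (λ r → c (d ℕ.+ r)) ≈ ∑pow (n ℕ.* q) c
      ∑pow-shift d {c} per = trans (pow*∑pow d (n ℕ.* q) (λ r → c (d ℕ.+ r))) (∑pow-rotate d {c} per)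

      -- Multiplication by pow d shifts the coefficient sequence cyclically, and
      -- q-periodic sequences are annihilated.
      difference-inverse : ∀ d j {c w h δ : ℕ → Carrier} →
        (∀ r → c (n ℕ.* q ℕ.+ r) ≈ c r) → (∀ r → δ (n ℕ.* q ℕ.+ r) ≈ δ r) →
        (∀ r → w (q ℕ.+ r) ≈ w r) → (∀ r → h (q ℕ.+ r) ≈ h r) →
        (∀ r → c r + w (d ℕ.+ r) ≈ c (d ℕ.+ r) + δ (d ℕ.+ r)) →
        (pow (j ℕ.+ d) - pow j) * ∑pow (n ℕ.* q) (λ r → c (j ℕ.+ r) - h r) ≈ ∑pow (n ℕ.* q) δ
      difference-inverse d j {c} {w} {h} {δ} c-per δ-per w-per h-per step = begin
        (pow (j ℕ.+ d) - pow j) * ∑pow M (λ r → c (j ℕ.+ r) - h r)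
          ≈⟨ *-cong (+-congʳ (trans (pow-+ j d) (*-comm _ _))) drop-h ⟩
        (pow d * pow j - pow j) * ∑pow M (λ r → c (j ℕ.+ r))
          ≈⟨ [y-z]x≈yx-zx _ _ _ ⟩
        pow d * pow j * ∑pow M (λ r → c (j ℕ.+ r)) - pow j * ∑pow M (λ r → c (j ℕ.+ r))
          -- The factor `pow j` is absorbed by the offset `j` in the index of `c`.
          ≈⟨ +-cong (trans (*-assoc _ _ _) (*-congˡ (∑pow-shift j {c} c-per)))
                    (-‿cong (∑pow-shift j {c} c-per)) ⟩
        pow d * ∑pow M c - ∑pow M c
          ≈⟨ +-congʳ shifted ⟩
        ∑pow M c + ∑pow M δ - ∑pow M c
          ≈⟨ xyx⁻¹≈y _ _ ⟩
        ∑pow M δ ∎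
        where
        M = n ℕ.* q

        drop-h : ∑pow M (λ r → c (j ℕ.+ r) - h r) ≈ ∑pow M (λ r → c (j ℕ.+ r))
        drop-h = begin
          ∑pow M (λ r → c (j ℕ.+ r) - h r)
            ≈⟨ ∑-cong M (λ r _ → distribʳ _ _ _) ⟩
          ∑ M (λ r → c (j ℕ.+ r) * pow r + - h r * pow r)
            ≈⟨ ∑-+ M ⟩
          ∑pow M (λ r → c (j ℕ.+ r)) + ∑pow M (λ r → - h r)
            ≈⟨ +-congˡ (∑pow-vanishes {λ r → - h r} λ r → -‿cong (h-per r)) ⟩
          ∑pow M (λ r → c (j ℕ.+ r)) + 0#
            ≈⟨ +-identityʳ _ ⟩
          ∑pow M (λ r → c (j ℕ.+ r)) ∎

        shifted : pow d * ∑pow M c ≈ ∑pow M c + ∑pow M δ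
        shifted = begin
          pow d * ∑pow M c
            ≈⟨ +-identityʳ _ ⟨
          pow d * ∑pow M c + 0#
            -- Zero is written as the rotated sum of the `q`-periodic `w`, supplying the term
            -- `w (d + r)` that `step` consumes.
            ≈⟨ +-congˡ (trans (∑pow-rotate d {w} (periodic-* q n {w} w-per)) (∑pow-vanishes {w} w-per)) ⟨
          pow d * ∑pow M c + ∑ M (λ r → w (d ℕ.+ r) * pow (d ℕ.+ r))
            ≈⟨ +-congʳ (pow*∑pow d M c) ⟩
          ∑ M (λ r → c r * pow (d ℕ.+ r)) + ∑ M (λ r → w (d ℕ.+ r) * pow (d ℕ.+ r))
            ≈⟨ ∑-+ M ⟨
          ∑ M (λ r → c r * pow (d ℕ.+ r) + w (d ℕ.+ r) * pow (d ℕ.+ r))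
            ≈⟨ ∑-cong M (λ r _ → begin
              c r * pow (d ℕ.+ r) + w (d ℕ.+ r) * pow (d ℕ.+ r)  ≈⟨ distribʳ _ _ _ ⟨
              (c r + w (d ℕ.+ r)) * pow (d ℕ.+ r)                ≈⟨ *-congʳ (step r) ⟩
              (c (d ℕ.+ r) + δ (d ℕ.+ r)) * pow (d ℕ.+ r)        ≈⟨ distribʳ _ _ _ ⟩
              c (d ℕ.+ r) * pow (d ℕ.+ r) + δ (d ℕ.+ r) * pow (d ℕ.+ r) ∎) ⟩
          ∑ M (λ r → c (d ℕ.+ r) * pow (d ℕ.+ r) + δ (d ℕ.+ r) * pow (d ℕ.+ r))
            ≈⟨ ∑-+ M ⟩
          ∑ M (λ r → c (d ℕ.+ r) * pow (d ℕ.+ r)) + ∑ M (λ r → δ (d ℕ.+ r) * pow (d ℕ.+ r))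
            ≈⟨ +-cong (∑pow-rotate d {c} c-per) (∑pow-rotate d {δ} δ-per) ⟩
          ∑pow M c + ∑pow M δ ∎

-- The quotient of a commutative ring by a principal ideal.

module Quotient {a ℓ} (R : CommutativeRing a ℓ) (f : CommutativeRing.Carrier R) where
  open CommutativeRing R
  open RingProperties ring using (-‿distribˡ-*; x[y-z]≈xy-xz; [y-z]x≈yx-zx)
  open AbelianGroupProperties +-abelianGroup using (⁻¹-∙-comm; ⁻¹-anti-homo‿-)
  open SetoidReasoning setoid
  open SemiringSolver commutativeSemiring using (solve; _:+_; _:*_; _:=_)

  infix 4 _∼_
  -- Over ℤ[x] the fields are, up to `coeffs`, the witness and the equation that `_≡_[mod_]` asks
  -- for.
  record _∼_ (x y : Carrier) : Set (a ⊔ ℓ) where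
    constructor by
    field
      multiplier : Carrier
      difference : x - y ≈ multiplier * f

  telescope : ∀ x y z → (x - y) + (y - z) ≈ x - z
  telescope x y z = begin
    (x - y) + (y - z)    ≈⟨ solve 4 (λ x y y′ z → ((x :+ y′) :+ (y :+ z)) := ((x :+ z) :+ (y :+ y′))) refl x y (- y) (- z) ⟩
    (x - z) + (y - y)    ≈⟨ trans (+-congˡ (-‿inverseʳ y)) (+-identityʳ _) ⟩
    x - z                ∎

  ≈⇒∼ : ∀ {x y} → x ≈ y → x ∼ y
  ≈⇒∼ {x} {y} x≈y = by 0# (begin
    x - y   ≈⟨ +-congʳ x≈y ⟩
    y - y   ≈⟨ -‿inverseʳ y ⟩
    0#      ≈⟨ zeroˡ f ⟨
    0# * f  ∎)

  ∼-sym : ∀ {x y} → x ∼ y → y ∼ x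
  ∼-sym {x} {y} (by q eq) = by (- q) (begin
    y - x      ≈⟨ ⁻¹-anti-homo‿- x y ⟨
    - (x - y)  ≈⟨ -‿cong eq ⟩
    - (q * f)  ≈⟨ -‿distribˡ-* q f ⟩
    - q * f    ∎)

  ∼-trans : ∀ {x y z} → x ∼ y → y ∼ z → x ∼ z
  ∼-trans {x} {y} {z} (by q eq) (by q′ eq′) = by (q + q′) (begin
    x - z              ≈⟨ telescope x y z ⟨
    (x - y) + (y - z)  ≈⟨ +-cong eq eq′ ⟩
    q * f + q′ * f     ≈⟨ distribʳ f q q′ ⟨
    (q + q′) * f       ∎)

  ∼-+-cong : ∀ {x y u v} → x ∼ y → u ∼ v → x + u ∼ y + v
  ∼-+-cong {x} {y} {u} {v} (by q eq) (by q′ eq′) = by (q + q′) (begin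
    (x + u) - (y + v)    ≈⟨ +-congˡ (⁻¹-∙-comm y v) ⟨
    (x + u) + (- y - v)  ≈⟨ solve 4 (λ x u y v → ((x :+ u) :+ (y :+ v)) := ((x :+ y) :+ (u :+ v))) refl x u (- y) (- v) ⟩
    (x - y) + (u - v)    ≈⟨ +-cong eq eq′ ⟩
    q * f + q′ * f       ≈⟨ distribʳ f q q′ ⟨
    (q + q′) * f         ∎)

  ∼-*-cong : ∀ {x y u v} → x ∼ y → u ∼ v → x * u ∼ y * v
  ∼-*-cong {x} {y} {u} {v} (by q eq) (by q′ eq′) = by (q * u + y * q′) (begin
    x * u - y * v                      ≈⟨ telescope (x * u) (y * u) (y * v) ⟨
    (x * u - y * u) + (y * u - y * v)  ≈⟨ +-cong ([y-z]x≈yx-zx u x y) (x[y-z]≈xy-xz y u v) ⟨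
    (x - y) * u + y * (u - v)          ≈⟨ +-cong (*-congʳ eq) (*-congˡ eq′) ⟩
    q * f * u + y * (q′ * f)           ≈⟨ solve 5 (λ q f u y q′ → (q :* f :* u :+ y :* (q′ :* f)) := ((q :* u :+ y :* q′) :* f)) refl q f u y q′ ⟩
    (q * u + y * q′) * f               ∎)

  ∼-‿cong : ∀ {x y} → x ∼ y → - x ∼ - y
  ∼-‿cong {x} {y} (by q eq) = by (- q) (begin
    - x - - y  ≈⟨ ⁻¹-∙-comm x (- y) ⟩
    - (x - y)  ≈⟨ -‿cong eq ⟩
    - (q * f)  ≈⟨ -‿distribˡ-* q f ⟩
    - q * f    ∎)

  quotientRing : CommutativeRing a (a ⊔ ℓ)
  quotientRing = record
    { Carrier = Carrier ; _≈_ = _∼_ ; _+_ = _+_ ; _*_ = _*_ ; -_ = -_ ; 0# = 0# ; 1# = 1#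
    ; isCommutativeRing = record
      { isRing = record
        { +-isAbelianGroup = record
          { isGroup = record
            { isMonoid = record
              { isSemigroup = record
                { isMagma = record
                  { isEquivalence = record { refl = ≈⇒∼ refl ; sym = ∼-sym ; trans = ∼-trans }
                  ; ∙-cong = ∼-+-cong
                  }
                ; assoc = λ x y z → ≈⇒∼ (+-assoc x y z)
                }
              ; identity = (λ x → ≈⇒∼ (+-identityˡ x)) , (λ x → ≈⇒∼ (+-identityʳ x))
              }
            ; inverse = (λ x → ≈⇒∼ (-‿inverseˡ x)) , (λ x → ≈⇒∼ (-‿inverseʳ x))
            ; ⁻¹-cong = ∼-‿cong
            }
          ; comm = λ x y → ≈⇒∼ (+-comm x y)
          }
        ; *-cong = ∼-*-cong
        ; *-assoc = λ x y z → ≈⇒∼ (*-assoc x y z)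
        ; *-identity = (λ x → ≈⇒∼ (*-identityˡ x)) , (λ x → ≈⇒∼ (*-identityʳ x))
        ; distrib = (λ x y z → ≈⇒∼ (distribˡ x y z)) , (λ x y z → ≈⇒∼ (distribʳ x y z))
        }
      ; *-comm = λ x y → ≈⇒∼ (*-comm x y)
      }
    }

open import Defs

-- The ring ℤ[x] of coefficient lists.

module PolynomialRing where

  -- _≈_ unfolds to a function type, from which f and g cannot be inferred.
  infix 4 _≋_
  record _≋_ (f g : Poly) : Set where
    constructor pointwise
    field coeffs : f ≈ g
  open _≋_ public

  refl : ∀ {f} → f ≋ f
  refl = pointwise λ k → ≡.refl

  sym : ∀ {f g} → f ≋ g → g ≋ f
  sym (pointwise f≈g) = pointwise λ k → ≡.sym (f≈g k)

  trans : ∀ {f g h} → f ≋ g → g ≋ h → f ≋ h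
  trans (pointwise f≈g) (pointwise g≈h) = pointwise λ k → ≡.trans (f≈g k) (g≈h k)

  setoid : Setoid 0ℓ 0ℓ
  setoid = record { Carrier = Poly ; _≈_ = _≋_ ; isEquivalence = record { refl = refl ; sym = sym ; trans = trans } }

  open SetoidReasoning setoid

  ∷-cong : ∀ {a b f g} → a ≡ b → f ≋ g → a ∷ f ≋ b ∷ g
  ∷-cong a≡b (pointwise f≈g) = pointwise λ { zero → a≡b ; (suc k) → f≈g k }

  coeff-+ : ∀ f g k → coeff (f + g) k ≡ coeff f k ℤ.+ coeff g k
  coeff-+ []      g       k       = ≡.sym (ℤ.+-identityˡ _)
  coeff-+ (a ∷ f) []      k       = ≡.sym (ℤ.+-identityʳ _)
  coeff-+ (a ∷ f) (b ∷ g) zero    = ≡.refl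
  coeff-+ (a ∷ f) (b ∷ g) (suc k) = coeff-+ f g k

  coeff-· : ∀ a f k → coeff (a · f) k ≡ a ℤ.* coeff f k
  coeff-· a []      k       = ≡.sym (ℤ.*-zeroʳ a)
  coeff-· a (b ∷ f) zero    = ≡.refl
  coeff-· a (b ∷ f) (suc k) = coeff-· a f k

  coeff-- : ∀ f g k → coeff (f - g) k ≡ coeff f k ℤ.- coeff g k
  coeff-- f g k rewrite coeff-+ f (-1ℤ · g) k | coeff-· -1ℤ g k | ℤ.-1*i≡-i (coeff g k) = ≡.refl

  +-cong : ∀ {f f′ g g′} → f ≋ f′ → g ≋ g′ → f + g ≋ f′ + g′
  +-cong {f} {f′} {g} {g′} (pointwise p) (pointwise q) = pointwise eq
    where
    eq : f + g ≈ f′ + g′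
    eq k rewrite coeff-+ f g k | coeff-+ f′ g′ k = ≡.cong₂ ℤ._+_ (p k) (q k)

  ·-cong : ∀ {a b f g} → a ≡ b → f ≋ g → a · f ≋ b · g
  ·-cong {a} {b} {f} {g} ≡.refl (pointwise p) = pointwise λ k →
    ≡.trans (coeff-· a f k) (≡.trans (≡.cong (a ℤ.*_) (p k)) (≡.sym (coeff-· a g k)))

  +-assoc : ∀ f g h → (f + g) + h ≋ f + (g + h)
  +-assoc f g h = pointwise eq
    where
    eq : (f + g) + h ≈ f + (g + h)
    eq k rewrite coeff-+ (f + g) h k | coeff-+ f g k | coeff-+ f (g + h) k | coeff-+ g h k =
      ℤ.+-assoc (coeff f k) (coeff g k) (coeff h k)

  +-comm : ∀ f g → f + g ≋ g + f
  +-comm f g = pointwise λ k → ≡.trans (coeff-+ f g k)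
    (≡.trans (ℤ.+-comm (coeff f k) (coeff g k)) (≡.sym (coeff-+ g f k)))

  +-identityʳ : ∀ f → f + [] ≋ f
  +-identityʳ f = +-comm f []

  +-commutativeSemigroup : CommutativeSemigroup 0ℓ 0ℓ
  +-commutativeSemigroup = record
    { isCommutativeSemigroup = record
      { isSemigroup = record
        { isMagma = record { isEquivalence = Setoid.isEquivalence setoid ; ∙-cong = +-cong }
        ; assoc = +-assoc
        }
      ; comm = +-comm
      }
    }

  open CommutativeSemigroupProperties +-commutativeSemigroup using (interchange; x∙yz≈y∙xz)

  ·-distribˡ : ∀ a f g → a · (f + g) ≋ a · f + a · g
  ·-distribˡ a f g = pointwise eq
    where
    eq : a · (f + g) ≈ a · f + a · g
    eq k rewrite coeff-· a (f + g) k | coeff-+ f g k | coeff-+ (a · f) (a · g) k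
                 | coeff-· a f k | coeff-· a g k = ℤ.*-distribˡ-+ a (coeff f k) (coeff g k)

  ·-distribʳ : ∀ a b f → (a ℤ.+ b) · f ≋ a · f + b · f
  ·-distribʳ a b f = pointwise eq
    where
    eq : (a ℤ.+ b) · f ≈ a · f + b · f
    eq k rewrite coeff-· (a ℤ.+ b) f k | coeff-+ (a · f) (b · f) k
                 | coeff-· a f k | coeff-· b f k = ℤ.*-distribʳ-+ (coeff f k) a b

  ·-assoc : ∀ a b f → (a ℤ.* b) · f ≋ a · (b · f)
  ·-assoc a b f = pointwise eq
    where
    eq : (a ℤ.* b) · f ≈ a · (b · f)
    eq k rewrite coeff-· (a ℤ.* b) f k | coeff-· a (b · f) k | coeff-· b f k =
      ℤ.*-assoc a b (coeff f k)

  ·-identity : ∀ f → 1ℤ · f ≋ f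
  ·-identity f = pointwise λ k → ≡.trans (coeff-· 1ℤ f k) (ℤ.*-identityˡ (coeff f k))

  ·-zero : ∀ f → 0ℤ · f ≋ []
  ·-zero f = pointwise λ k → ≡.trans (coeff-· 0ℤ f k) (ℤ.*-zeroˡ (coeff f k))

  0∷[] : 0ℤ ∷ [] ≋ []
  0∷[] = pointwise λ { zero → ≡.refl ; (suc k) → ≡.refl }

  -‿inverseʳ : ∀ f → f - f ≋ []
  -‿inverseʳ f = pointwise λ k → ≡.trans (coeff-- f f k) (ℤ.+-inverseʳ (coeff f k))

  *-congˡ : ∀ f {g g′} → g ≋ g′ → f * g ≋ f * g′
  *-congˡ []      g≋g′ = refl
  *-congˡ (a ∷ f) g≋g′ = +-cong (·-cong {a} ≡.refl g≋g′) (∷-cong ≡.refl (*-congˡ f g≋g′))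

  *-zeroʳ : ∀ f → f * [] ≋ []
  *-zeroʳ []      = refl
  *-zeroʳ (a ∷ f) = trans (∷-cong ≡.refl (*-zeroʳ f)) 0∷[]

  -- `_*_` recurses on its left factor; this is the mirror recursion on the right one, from which
  -- commutativity follows by induction.
  *-∷ : ∀ f a g → f * (a ∷ g) ≋ a · f + (0ℤ ∷ f * g)
  *-∷ []      a g = sym 0∷[]
  *-∷ (b ∷ f) a g = ∷-cong (≡.cong (ℤ._+ 0ℤ) (ℤ.*-comm b a)) (begin
    b · g + f * (a ∷ g)             ≈⟨ +-cong refl (*-∷ f a g) ⟩
    b · g + (a · f + (0ℤ ∷ f * g))  ≈⟨ x∙yz≈y∙xz (b · g) (a · f) (0ℤ ∷ f * g) ⟩
    a · f + (b · g + (0ℤ ∷ f * g))  ∎)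

  *-comm : ∀ f g → f * g ≋ g * f
  *-comm []      g = sym (*-zeroʳ g)
  *-comm (a ∷ f) g = trans (+-cong refl (∷-cong ≡.refl (*-comm f g))) (sym (*-∷ g a f))

  -- Equal polynomials may be lists of different lengths, so congruence in the left factor is
  -- obtained from `*-congˡ` by commutativity rather than by a joint induction.
  *-cong : ∀ {f f′ g g′} → f ≋ f′ → g ≋ g′ → f * g ≋ f′ * g′
  *-cong {f} {f′} {g} {g′} p q = begin
    f * g    ≈⟨ *-congˡ f q ⟩
    f * g′   ≈⟨ *-comm f g′ ⟩
    g′ * f   ≈⟨ *-congˡ g′ p ⟩
    g′ * f′  ≈⟨ *-comm g′ f′ ⟩
    f′ * g′  ∎

  *-distribʳ : ∀ h f g → (f + g) * h ≋ f * h + g * h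
  *-distribʳ h []      g       = refl
  *-distribʳ h (a ∷ f) []      = sym (+-identityʳ _)
  *-distribʳ h (a ∷ f) (b ∷ g) = begin
    (a ℤ.+ b) · h + (0ℤ ∷ (f + g) * h)
      ≈⟨ +-cong (·-distribʳ a b h) (∷-cong ≡.refl (*-distribʳ h f g)) ⟩
    (a · h + b · h) + ((0ℤ ∷ f * h) + (0ℤ ∷ g * h))
      ≈⟨ interchange (a · h) (b · h) (0ℤ ∷ f * h) (0ℤ ∷ g * h) ⟩
    (a · h + (0ℤ ∷ f * h)) + (b · h + (0ℤ ∷ g * h)) ∎

  ·-*-assoc : ∀ a f g → (a · f) * g ≋ a · (f * g)
  ·-*-assoc a []      g = refl
  ·-*-assoc a (b ∷ f) g = begin
    (a ℤ.* b) · g + (0ℤ ∷ (a · f) * g)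
      ≈⟨ +-cong (·-assoc a b g) (∷-cong (≡.sym (ℤ.*-zeroʳ a)) (·-*-assoc a f g)) ⟩
    a · (b · g) + a · (0ℤ ∷ f * g)
      ≈⟨ ·-distribˡ a (b · g) (0ℤ ∷ f * g) ⟨
    a · (b · g + (0ℤ ∷ f * g)) ∎

  0∷-* : ∀ f g → (0ℤ ∷ f) * g ≋ 0ℤ ∷ f * g
  0∷-* f g = +-cong (·-zero g) refl

  *-assoc : ∀ f g h → (f * g) * h ≋ f * (g * h)
  *-assoc []      g h = refl
  *-assoc (a ∷ f) g h = begin
    (a · g + (0ℤ ∷ f * g)) * h            ≈⟨ *-distribʳ h (a · g) (0ℤ ∷ f * g) ⟩
    (a · g) * h + (0ℤ ∷ f * g) * h        ≈⟨ +-cong (·-*-assoc a g h) (0∷-* (f * g) h) ⟩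
    a · (g * h) + (0ℤ ∷ (f * g) * h)      ≈⟨ +-cong refl (∷-cong ≡.refl (*-assoc f g h)) ⟩
    a · (g * h) + (0ℤ ∷ f * (g * h))      ∎

  const-* : ∀ a f → const a * f ≋ a · f
  const-* a f = trans (+-cong refl 0∷[]) (+-identityʳ (a · f))

  *-identityˡ : ∀ f → const 1ℤ * f ≋ f
  *-identityˡ f = trans (const-* 1ℤ f) (·-identity f)

  commutativeRing : CommutativeRing 0ℓ 0ℓ
  commutativeRing = record
    -- Negation is `-1ℤ ·_`, so that subtraction in this ring unfolds to `_-_` on polynomials.
    { Carrier = Poly ; _≈_ = _≋_ ; _+_ = _+_ ; _*_ = _*_ ; -_ = -1ℤ ·_ ; 0# = [] ; 1# = const 1ℤ
    ; isCommutativeRing = record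
      { isRing = record
        { +-isAbelianGroup = record
          { isGroup = record
            { isMonoid = record
              { isSemigroup = CommutativeSemigroup.isSemigroup +-commutativeSemigroup
              ; identity = (λ f → refl) , +-identityʳ
              }
            ; inverse = (λ f → trans (+-comm (-1ℤ · f) f) (-‿inverseʳ f)) , -‿inverseʳ
            ; ⁻¹-cong = ·-cong { -1ℤ} ≡.refl
            }
          ; comm = +-comm
          }
        ; *-cong = *-cong
        ; *-assoc = *-assoc
        ; *-identity = *-identityˡ , λ f → trans (*-comm f (const 1ℤ)) (*-identityˡ f)
        ; distrib = (λ f g h → trans (*-comm f (g + h)) (trans (*-distribʳ f g h) (+-cong (*-comm g f) (*-comm h f))))
                  , *-distribʳ
        }
      ; *-comm = *-comm
      }
    }

  X^-+ : ∀ m n → X^ (m ℕ.+ n) ≋ X^ m * X^ n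
  X^-+ zero    n = sym (*-identityˡ (X^ n))
  X^-+ (suc m) n = trans (∷-cong ≡.refl (X^-+ m n)) (sym (0∷-* (X^ m) (X^ n)))

open PolynomialRing using
  (_≋_; pointwise; coeffs; commutativeRing; coeff-+; coeff-·; coeff--; ∷-cong; 0∷[]; 0∷-*; ·-zero; X^-+)

-- Long division by monic polynomials.

module Division where
  open CommutativeRing commutativeRing using
    (setoid; refl; sym; trans; +-congʳ; +-congˡ; +-assoc; *-congʳ; ring; -‿cong)
  module ≋-Reasoning = SetoidReasoning setoid
  open RingProperties ring using ([y-z]x≈yx-zx; xyx⁻¹≈y; x∙y⁻¹≈ε⇒x≈y)

  -- Degree less than `n`, expressed through coefficients because trailing zeros are allowed; for
  -- `n` = 0 it means the zero polynomial.
  Below : ℕ → Poly → Set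
  Below n f = ∀ k → n ≤ k → coeff f k ≡ 0ℤ

  record Monic (n : ℕ) (f : Poly) : Set where
    constructor monic
    field
      leading : coeff f n ≡ 1ℤ
      higher  : Below (suc n) f
  open Monic public

  Below-resp : ∀ {n f g} → f ≋ g → Below n f → Below n g
  Below-resp (pointwise f≈g) f<n k n≤k = ≡.trans (≡.sym (f≈g k)) (f<n k n≤k)

  Monic-resp : ∀ {n f g} → f ≋ g → Monic n f → Monic n g
  Monic-resp {n} f≋g (monic l h) = monic (≡.trans (≡.sym (coeffs f≋g n)) l) (Below-resp f≋g h)

  Below-take : ∀ n f → Below n (take n f)
  Below-take zero    f       k       n≤k       = ≡.refl
  Below-take (suc n) []      k       n≤k       = ≡.refl
  Below-take (suc n) (a ∷ f) (suc k) (s≤s n≤k) = Below-take n f k n≤k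

  take-Below : ∀ n {f} → Below n f → take n f ≋ f
  take-Below zero            f<n = pointwise λ k → ≡.sym (f<n k z≤n)
  take-Below (suc n) {[]}    f<n = refl
  take-Below (suc n) {a ∷ f} f<n = ∷-cong ≡.refl (take-Below n λ k n≤k → f<n (suc k) (s≤s n≤k))

  ≈[]⇒All≡0 : ∀ f → f ≈ [] → All (_≡ 0ℤ) f
  ≈[]⇒All≡0 []      f≈[] = []
  ≈[]⇒All≡0 (a ∷ f) f≈[] = f≈[] 0 ∷ ≈[]⇒All≡0 f λ k → f≈[] (suc k)

  All≡0⇒≈[] : ∀ {f} → All (_≡ 0ℤ) f → f ≈ []
  All≡0⇒≈[] []          k       = ≡.refl
  All≡0⇒≈[] (a≡0 ∷ f≡0) zero    = a≡0
  All≡0⇒≈[] (a≡0 ∷ f≡0) (suc k) = All≡0⇒≈[] f≡0 k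

  0ℤ≢1ℤ : 0ℤ ≢ 1ℤ
  0ℤ≢1ℤ ()

  -- The bridge from the computed `degree`, on which `reduce` and `quot` depend, to the
  -- coefficientwise `Monic`.
  degree-monic : ∀ n {f} → Monic n f → degree f ≡ n
  degree-monic n       {[]}    (monic l h) = contradiction l 0ℤ≢1ℤ
  degree-monic n       {a ∷ f} (monic l h) with all? (ℤ._≟ 0ℤ) f
  degree-monic zero    {a ∷ f} (monic l h) | yes f≡0 = ≡.refl
  degree-monic zero    {a ∷ f} (monic l h) | no  f≢0 =
    contradiction (≈[]⇒All≡0 f λ k → h (suc k) (s≤s z≤n)) f≢0
  degree-monic (suc n) {a ∷ f} (monic l h) | yes f≡0 =
    contradiction (≡.trans (≡.sym (All≡0⇒≈[] f≡0 n)) l) 0ℤ≢1ℤ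
  degree-monic (suc n) {a ∷ f} (monic l h) | no  f≢0 =
    ≡.cong suc (degree-monic n {f} (monic l λ k n<k → h (suc k) (s≤s n<k)))

  Below-rem : ∀ f g → Below (degree f) (g rem f)
  Below-rem f []      k _ = ≡.refl
  Below-rem f (a ∷ g) = Below-take (degree f) _

  Below-∷ : ∀ {n a f} → Below n f → Below (suc n) (a ∷ f)
  Below-∷ f<n (suc k) (s≤s n≤k) = f<n k n≤k

  coeff-∷-* : ∀ a h f k → coeff ((a ∷ h) * f) k ≡ a ℤ.* coeff f k ℤ.+ coeff (0ℤ ∷ h * f) k
  coeff-∷-* a h f k = ≡.trans (coeff-+ (a · f) (0ℤ ∷ h * f) k)
    (≡.cong (ℤ._+ coeff (0ℤ ∷ h * f) k) (coeff-· a f k))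

  module _ {n f} (f-monic : Monic n f) where

    -- In degrees above `n` only `0ℤ ∷ h * f` contributes to the product, so `h * f` is again below
    -- `n` and `h` vanishes by induction; the coefficient in degree `n` is then `a`.
    Below-multiple : ∀ h → Below n (h * f) → h ≋ []
    Below-multiple []      hf<n = refl
    Below-multiple (a ∷ h) hf<n = trans (∷-cong a≡0 h≋[]) 0∷[]
      where
      open ≡.≡-Reasoning

      hf<n′ : Below n (h * f)
      hf<n′ k n≤k = begin
        coeff (h * f) k
          ≡⟨ ℤ.+-identityˡ _ ⟨
        0ℤ ℤ.+ coeff (h * f) k
          ≡⟨ ≡.cong (ℤ._+ coeff (h * f) k) (ℤ.*-zeroʳ a) ⟨
        a ℤ.* 0ℤ ℤ.+ coeff (h * f) k
          ≡⟨ ≡.cong (λ x → a ℤ.* x ℤ.+ coeff (h * f) k) (higher f-monic (suc k) (s≤s n≤k)) ⟨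
        a ℤ.* coeff f (suc k) ℤ.+ coeff (h * f) k
          ≡⟨ coeff-∷-* a h f (suc k) ⟨
        coeff ((a ∷ h) * f) (suc k)
          ≡⟨ hf<n (suc k) (ℕ.m≤n⇒m≤1+n n≤k) ⟩
        0ℤ ∎

      h≋[] : h ≋ []
      h≋[] = Below-multiple h hf<n′

      0∷hf≋[] : 0ℤ ∷ h * f ≋ []
      0∷hf≋[] = trans (∷-cong ≡.refl (*-congʳ h≋[])) 0∷[]

      a≡0 : a ≡ 0ℤ
      a≡0 = begin
        a                                         ≡⟨ ℤ.*-identityʳ a ⟨
        a ℤ.* 1ℤ                                  ≡⟨ ℤ.+-identityʳ _ ⟨
        a ℤ.* 1ℤ ℤ.+ 0ℤ                           ≡⟨ ≡.cong₂ (λ x y → a ℤ.* x ℤ.+ y) (leading f-monic) (coeffs 0∷hf≋[] n) ⟨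
        a ℤ.* coeff f n ℤ.+ coeff (0ℤ ∷ h * f) n  ≡⟨ coeff-∷-* a h f n ⟨
        coeff ((a ∷ h) * f) n                     ≡⟨ hf<n n ℕ.≤-refl ⟩
        0ℤ                                        ∎

    -- The subtracted multiple of `f` cancels the coefficient in degree `n`, so `take` discards only
    -- zeros.
    reduce-Below : ∀ {h} → Below (suc n) h → reduce f h ≋ h - coeff h n · f
    reduce-Below {h} h≤n rewrite degree-monic n f-monic = take-Below n below
      where
      open ≡.≡-Reasoning
      c = coeff h n

      cancels : ∀ k → n ≤ k → coeff h k ≡ c ℤ.* coeff f k
      cancels k n≤k with ℕ.m≤n⇒m<n∨m≡n n≤k
      ... | inj₁ n<k = begin
        coeff h k        ≡⟨ h≤n k n<k ⟩
        0ℤ               ≡⟨ ℤ.*-zeroʳ c ⟨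
        c ℤ.* 0ℤ         ≡⟨ ≡.cong (c ℤ.*_) (higher f-monic k n<k) ⟨
        c ℤ.* coeff f k  ∎
      ... | inj₂ ≡.refl = begin
        c                ≡⟨ ℤ.*-identityʳ c ⟨
        c ℤ.* 1ℤ         ≡⟨ ≡.cong (c ℤ.*_) (leading f-monic) ⟨
        c ℤ.* coeff f k  ∎

      below : Below n (h - c · f)
      below k n≤k = begin
        coeff (h - c · f) k              ≡⟨ coeff-- h (c · f) k ⟩
        coeff h k ℤ.- coeff (c · f) k    ≡⟨ ℤ.i≡j⇒i-j≡0 (≡.trans (cancels k n≤k) (≡.sym (coeff-· c f k))) ⟩
        0ℤ                               ∎

    Below-rem′ : ∀ g → Below n (g rem f)
    Below-rem′ g = ≡.subst (λ d → Below d (g rem f)) (degree-monic n f-monic) (Below-rem f g)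

    division : ∀ g → g ≋ (g quot f) * f + g rem f
    division []      = refl
    division (a ∷ g) = begin
      a ∷ g
        ≈⟨ ∷-cong (≡.sym (ℤ.+-identityˡ a)) (division g) ⟩
      (0ℤ ∷ q * f) + (a ∷ r)
        ≈⟨ xyx⁻¹≈y (c · f) _ ⟨
      (c · f + ((0ℤ ∷ q * f) + (a ∷ r))) - c · f
        -- `(c ∷ q) * f` unfolds to `c · f + (0ℤ ∷ q * f)`: a multiple of `f` moves from the
        -- remainder to the quotient.
        ≈⟨ +-congʳ (+-assoc (c · f) (0ℤ ∷ q * f) (a ∷ r)) ⟨
      ((c ∷ q) * f + (a ∷ r)) - c · f
        ≈⟨ +-assoc ((c ∷ q) * f) (a ∷ r) (-1ℤ · (c · f)) ⟩
      (c ∷ q) * f + ((a ∷ r) - c · f)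
        ≈⟨ +-congˡ (reduce-Below (Below-∷ (Below-rem′ g))) ⟨
      (c ∷ q) * f + reduce f (a ∷ r)
        ≡⟨ ≡.cong (λ d → (coeff (a ∷ r) d ∷ q) * f + reduce f (a ∷ r)) (degree-monic n f-monic) ⟨
      ((a ∷ g) quot f) * f + (a ∷ g) rem f ∎
      where
      open ≋-Reasoning
      q = g quot f
      r = g rem f
      c = coeff (a ∷ r) n

    -- The error in the quotient, times `f`, is the remainder, which is below `n`; `Below-multiple`
    -- makes the error zero.
    quot-unique : ∀ {g h} → g ≋ h * f → g quot f ≋ h
    quot-unique {g} {h} g≋hf = sym (x∙y⁻¹≈ε⇒x≈y _ _ (Below-multiple (h - g quot f) (Below-resp (sym eq) (Below-rem′ g))))
      where
      open ≋-Reasoning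
      eq : (h - g quot f) * f ≋ g rem f
      eq = begin
        (h - g quot f) * f                               ≈⟨ [y-z]x≈yx-zx f h (g quot f) ⟩
        h * f - (g quot f) * f                           ≈⟨ +-congʳ g≋hf ⟨
        g - (g quot f) * f                               ≈⟨ +-congʳ (division g) ⟩
        (g quot f) * f + g rem f - (g quot f) * f        ≈⟨ xyx⁻¹≈y ((g quot f) * f) _ ⟩
        g rem f                                          ∎

    -- At every step the coefficient in degree `n` is zero and nothing is subtracted. The norm of a
    -- polynomial of degree below that of Φ can thus be read off its own coefficients.
    rem-Below : ∀ {g} → Below n g → g rem f ≋ g
    rem-Below {[]}    g<n = refl
    rem-Below {a ∷ g} g<n = begin
      reduce f (a ∷ r)      ≈⟨ reduce-Below (Below-∷ (Below-rem′ g)) ⟩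
      (a ∷ r) - c · f       ≡⟨ ≡.cong (λ x → (a ∷ r) - x · f) (≡.trans (coeffs a∷r≋a∷g n) (g<n n ℕ.≤-refl)) ⟩
      (a ∷ r) - 0ℤ · f      ≈⟨ +-congˡ {a ∷ r} (-‿cong (·-zero f)) ⟩
      a ∷ r                 ≈⟨ a∷r≋a∷g ⟩
      a ∷ g                 ∎
      where
      open ≋-Reasoning
      r = g rem f
      c = coeff (a ∷ r) n

      a∷r≋a∷g : a ∷ r ≋ a ∷ g
      a∷r≋a∷g = ∷-cong ≡.refl (rem-Below λ k n≤k → g<n (suc k) (ℕ.m≤n⇒m≤1+n n≤k))

  -- The bound is assumed on `coeff`, since the remainder is known only up to `_≋_`, not as a list.
  coeff-bound⇒max-bound : ∀ f {b} → (∀ k → ∣ coeff f k ∣ ≤ b) → max 0 (map ∣_∣ f) ≤ b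
  coeff-bound⇒max-bound f f≤b = max≤v⁺ z≤n (all f f≤b)
    where
    all : ∀ f {b} → (∀ k → ∣ coeff f k ∣ ≤ b) → All (_≤ b) (map ∣_∣ f)
    all []      f≤b = []
    all (a ∷ f) f≤b = f≤b 0 ∷ all f λ k → f≤b (suc k)

-- Divisors of a prime power.

module FilterUpTo {ℓ} {P : Pred ℕ ℓ} (P? : Decidable P) where

  filter-upTo-suc : ∀ n → filter P? (upTo (suc n)) ≡ filter P? (upTo n) ++ filter P? [ n ]
  filter-upTo-suc n = ≡.trans (≡.cong (filter P?) (≡.sym (upTo-∷ʳ n))) (filter-++ P? (upTo n) [ n ])

  filter-upTo-accept : ∀ {n} → P n → filter P? (upTo (suc n)) ≡ filter P? (upTo n) ∷ʳ n
  filter-upTo-accept {n} Pn =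
    ≡.trans (filter-upTo-suc n) (≡.cong (filter P? (upTo n) ++_) (filter-accept P? Pn))

  filter-upTo-reject : ∀ {n} → ¬ P n → filter P? (upTo (suc n)) ≡ filter P? (upTo n)
  filter-upTo-reject {n} ¬Pn = ≡.trans (filter-upTo-suc n)
    (≡.trans (≡.cong (filter P? (upTo n) ++_) (filter-reject P? ¬Pn)) (++-identityʳ _))

  filter-upTo-+ : ∀ m k → (∀ r → m ≤ r → r < m ℕ.+ k → ¬ P r) →
    filter P? (upTo (m ℕ.+ k)) ≡ filter P? (upTo m)
  filter-upTo-+ m zero    ¬P = ≡.cong (λ n → filter P? (upTo n)) (ℕ.+-identityʳ m)
  filter-upTo-+ m (suc k) ¬P rewrite ℕ.+-suc m k = ≡.trans
    (filter-upTo-reject (¬P (m ℕ.+ k) (ℕ.m≤m+n m k) ℕ.≤-refl))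
    (filter-upTo-+ m k λ r m≤r r<m+k → ¬P r m≤r (ℕ.m<n⇒m<1+n r<m+k))

open FilterUpTo

filter-upTo-⇔ : ∀ {ℓ₁ ℓ₂} {P : Pred ℕ ℓ₁} {Q : Pred ℕ ℓ₂} (P? : Decidable P) (Q? : Decidable Q) n →
  (∀ r → r < n → P r ⇔ Q r) → filter P? (upTo n) ≡ filter Q? (upTo n)
filter-upTo-⇔ P? Q? zero    P⇔Q = ≡.refl
filter-upTo-⇔ P? Q? (suc n) P⇔Q
  with ih ← filter-upTo-⇔ P? Q? n (λ r r<n → P⇔Q r (ℕ.m<n⇒m<1+n r<n)) | P? n
... | yes Pn = ≡.trans (filter-upTo-accept P? Pn)
  (≡.trans (≡.cong (_∷ʳ n) ih) (≡.sym (filter-upTo-accept Q? (Equivalence.to (P⇔Q n ℕ.≤-refl) Pn))))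
... | no ¬Pn = ≡.trans (filter-upTo-reject P? ¬Pn)
  (≡.trans ih (≡.sym (filter-upTo-reject Q? λ Qn → ¬Pn (Equivalence.from (P⇔Q n ℕ.≤-refl) Qn))))

module PrimePower {p} (p-prime : Prime p) where

  instance
    p-nonZero : NonZero p
    p-nonZero = prime⇒nonZero p-prime

  1<p : 1 < p
  1<p = ℕ.nonTrivial⇒n>1 p ⦃ prime⇒nonTrivial p-prime ⦄

  p^-nonZero : ∀ n → NonZero (p ^ n)
  p^-nonZero n = ℕ.m^n≢0 p n

  p^n<p^1+n : ∀ n → p ^ n < p ^ suc n
  p^n<p^1+n n = ℕ.^-monoʳ-< p 1<p (ℕ.n<1+n n)

  -- If `p` does not divide `k`, the two are coprime and the factors `p` can be cancelled one at a
  -- time until `k` divides 1.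
  ∣p^n⇒≡1∨p∣ : ∀ n {k} → k ∣ p ^ n → k ≡ 1 ⊎ p ∣ k
  ∣p^n⇒≡1∨p∣ zero    k∣1 = inj₁ (∣1⇒≡1 k∣1)
  ∣p^n⇒≡1∨p∣ (suc n) {k} k∣p^1+n with p ∣? k
  ... | yes p∣k = inj₂ p∣k
  ... | no  p∤k = ∣p^n⇒≡1∨p∣ n (coprime-divisor coprime k∣p^1+n)
    where
    coprime : Coprime k p
    coprime (d∣k , d∣p) with prime⇒irreducible p-prime d∣p
    ... | inj₁ d≡1    = d≡1
    ... | inj₂ ≡.refl = contradiction d∣k p∤k

  -- The preceding dichotomy is applied to the cofactor `l`: it is 1, or it contains a factor `p` to
  -- cancel.
  ∣p^1+n⇒≡∨∣p^n : ∀ n {k} → k ∣ p ^ suc n → k ≡ p ^ suc n ⊎ k ∣ p ^ n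
  ∣p^1+n⇒≡∨∣p^n n {k} (divides l eq) with ∣p^n⇒≡1∨p∣ (suc n) (divides k (≡.trans eq (ℕ.*-comm l k)))
  ... | inj₁ ≡.refl           = inj₁ (≡.sym (≡.trans eq (ℕ.+-identityʳ k)))
  ... | inj₂ (divides m ≡.refl) = inj₂ (divides m (ℕ.*-cancelˡ-≡ _ _ p (begin
    p ℕ.* p ^ n        ≡⟨ eq ⟩
    m ℕ.* p ℕ.* k      ≡⟨ ≡.cong (ℕ._* k) (ℕ.*-comm m p) ⟩
    p ℕ.* m ℕ.* k      ≡⟨ ℕ.*-assoc p m k ⟩
    p ℕ.* (m ℕ.* k)    ∎)))
    where open ≡.≡-Reasoning

  -- Below `p ^ n` the two powers have the same divisors, and strictly between them there are none.
  -- As `upTo` is increasing, the new divisor comes last.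
  properDivisors-p^1+n : ∀ n → properDivisors (p ^ suc n) ≡ properDivisors (p ^ n) ∷ʳ p ^ n
  properDivisors-p^1+n n with k , eq ← ℕ.m≤n⇒∃[o]m+o≡n (p^n<p^1+n n) = begin
    filter (_∣? p ^ suc n) (upTo (p ^ suc n))
      ≡⟨ ≡.cong (λ m → filter (_∣? p ^ suc n) (upTo m)) eq ⟨
    filter (_∣? p ^ suc n) (upTo (suc (p ^ n) ℕ.+ k))
      ≡⟨ filter-upTo-+ (_∣? p ^ suc n) (suc (p ^ n)) k between ⟩
    filter (_∣? p ^ suc n) (upTo (suc (p ^ n)))
      ≡⟨ filter-upTo-accept (_∣? p ^ suc n) (n∣m*n p) ⟩
    filter (_∣? p ^ suc n) (upTo (p ^ n)) ∷ʳ p ^ n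
      ≡⟨ ≡.cong (_∷ʳ p ^ n) (filter-upTo-⇔ (_∣? p ^ suc n) (_∣? p ^ n) (p ^ n) below) ⟩
    filter (_∣? p ^ n) (upTo (p ^ n)) ∷ʳ p ^ n ∎
    where
    open ≡.≡-Reasoning

    between : ∀ r → suc (p ^ n) ≤ r → r < suc (p ^ n) ℕ.+ k → ¬ (r ∣ p ^ suc n)
    between r p^n<r r<p^1+n r∣p^1+n with ∣p^1+n⇒≡∨∣p^n n r∣p^1+n
    ... | inj₁ r≡p^1+n = ℕ.<⇒≢ r<p^1+n (≡.trans r≡p^1+n (≡.sym eq))
    ... | inj₂ r∣p^n   = ℕ.<⇒≱ p^n<r (∣⇒≤ ⦃ p^-nonZero n ⦄ r∣p^n)

    below : ∀ r → r < p ^ n → (r ∣ p ^ suc n) ⇔ (r ∣ p ^ n)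
    below r r<p^n = mk⇔ to (∣n⇒∣m*n p)
      where
      to : r ∣ p ^ suc n → r ∣ p ^ n
      to r∣p^1+n with ∣p^1+n⇒≡∨∣p^n n r∣p^1+n
      ... | inj₁ r≡p^1+n = contradiction r≡p^1+n (ℕ.<⇒≢ (ℕ.<-trans r<p^n (p^n<p^1+n n)))
      ... | inj₂ r∣p^n   = r∣p^n

-- Monic polynomials and the cyclotomic polynomials of prime power order.

module MonicPolynomials where
  open CommutativeRing commutativeRing using (+-comm)
  open Sums commutativeRing
  open Division

  Below-≤ : ∀ {m n f} → m ≤ n → Below m f → Below n f
  Below-≤ m≤n f<m k n≤k = f<m k (ℕ.≤-trans m≤n n≤k)

  Below-+ : ∀ {n f g} → Below n f → Below n g → Below n (f + g)
  Below-+ {n} {f} {g} f<n g<n k n≤k =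
    ≡.trans (coeff-+ f g k) (≡.cong₂ ℤ._+_ (f<n k n≤k) (g<n k n≤k))

  Below-· : ∀ {n f} a → Below n f → Below n (a · f)
  Below-· {n} {f} a f<n k n≤k =
    ≡.trans (coeff-· a f k) (≡.trans (≡.cong (a ℤ.*_) (f<n k n≤k)) (ℤ.*-zeroʳ a))

  Below-∑ : ∀ n N {F} → (∀ r → r < n → Below N (F r)) → Below N (∑ n F)
  Below-∑ zero    N F<N k N≤k = ≡.refl
  Below-∑ (suc n) N F<N = Below-+ {N} {∑ n _}
    (Below-∑ n N λ r r<n → F<N r (ℕ.m<n⇒m<1+n r<n)) (F<N n ℕ.≤-refl)

  Monic-+ : ∀ {n f g} → Monic n f → Below n g → Monic n (f + g)
  Monic-+ {n} {f} {g} (monic l h) g<n = monic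
    (≡.trans (coeff-+ f g n) (≡.cong₂ ℤ._+_ l (g<n n ℕ.≤-refl)))
    (Below-+ {suc n} {f} h (Below-≤ {n} {suc n} {g} (ℕ.n≤1+n n) g<n))

  Monic-X^ : ∀ n → Monic n (X^ n)
  Monic-X^ n = monic (leading-X^ n) (higher-X^ n)
    where
    leading-X^ : ∀ n → coeff (X^ n) n ≡ 1ℤ
    leading-X^ zero    = ≡.refl
    leading-X^ (suc n) = leading-X^ n

    higher-X^ : ∀ n → Below (suc n) (X^ n)
    higher-X^ zero    (suc k) _         = ≡.refl
    higher-X^ (suc n) (suc k) (s≤s n<k) = higher-X^ n k n<k

  Monic-X^-1 : ∀ {n} → 0 < n → Monic n (X^ n - X^ 0)
  Monic-X^-1 {n} 0<n = Monic-+ {n} {X^ n} (Monic-X^ n)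
    (Below-· {n} {X^ 0} -1ℤ (Below-≤ {1} {n} {X^ 0} 0<n (higher (Monic-X^ 0))))

  -- The last summand carries the leading term. For `n` = p - 1 and `q` a power of p, the degree is
  -- φ(pq).
  Monic-∑X^ : ∀ n q → 0 < q → Monic (n ℕ.* q) (∑ (suc n) (λ k → X^ (k ℕ.* q)))
  Monic-∑X^ n q 0<q = Monic-resp (+-comm (X^ (n ℕ.* q)) _) (Monic-+ {f = X^ (n ℕ.* q)} (Monic-X^ (n ℕ.* q))
    (Below-∑ n (n ℕ.* q) λ k k<n → Below-≤ {f = X^ (k ℕ.* q)}
      (ℕ.*-monoˡ-< q ⦃ ℕ.>-nonZero 0<q ⦄ k<n) (higher (Monic-X^ (k ℕ.* q)))))

module Cyclotomic {p} (p-prime : Prime p) where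
  open CommutativeRing commutativeRing using (setoid; refl; sym; trans; *-congʳ; *-cong; *-identityˡ; *-identityʳ; *-assoc; *-comm)
  open Sums commutativeRing
  open Powers X^_ refl X^-+
  open PrimePower p-prime
  open Division
  open MonicPolynomials
  open SetoidReasoning setoid

  ∏-++ : ∀ fs gs → ∏ (fs ++ gs) ≋ ∏ fs * ∏ gs
  ∏-++ []       gs = sym (*-identityˡ _)
  ∏-++ (f ∷ fs) gs = trans (*-cong {f} refl (∏-++ fs gs)) (sym (*-assoc f (∏ fs) (∏ gs)))

  -- The closed form of Φ at `p ^ s`.
  Ψ : ℕ → Poly
  Ψ zero    = X^ 1 - X^ 0
  Ψ (suc s) = ∑ p (λ k → X^ (k ℕ.* p ^ s))

  -- The product of the cyclotomic polynomials over the proper divisors of `p ^ s`, that is, over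
  -- all divisors of the previous power, if there is one.
  denominator : ℕ → Poly
  denominator zero    = const 1ℤ
  denominator (suc s) = X^ (p ^ s) - X^ 0

  denominator-*-Ψ : ∀ s → denominator s * Ψ s ≋ X^ (p ^ s) - X^ 0
  denominator-*-Ψ zero    = *-identityˡ _
  denominator-*-Ψ (suc s) = geometric (p ^ s) p

  0<p^ : ∀ s → 0 < p ^ s
  0<p^ s = ℕ.m^n>0 p s

  denominator-degree : ℕ → ℕ
  denominator-degree zero    = 0
  denominator-degree (suc s) = p ^ s

  Monic-denominator : ∀ s → Monic (denominator-degree s) (denominator s)
  Monic-denominator zero    = Monic-X^ 0
  Monic-denominator (suc s) = Monic-X^-1 (0<p^ s)

  -- A mutual induction: the product determines Φ as an exact quotient, and the last factor of the
  -- product is Φ at the previous power. The product needs only the bound `suc b` because proper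
  -- divisors are strictly smaller.
  cyclotomic≋Ψ : ∀ s b → p ^ s ≤ b → cyclotomic b (p ^ s) ≋ Ψ s
  ∏-cyclotomic : ∀ s b → p ^ s ≤ suc b →
    ∏ (map (cyclotomic b) (properDivisors (p ^ s))) ≋ denominator s

  cyclotomic≋Ψ s zero    p^s≤0 = contradiction p^s≤0 (ℕ.<⇒≱ (0<p^ s))
  cyclotomic≋Ψ s (suc b) p^s≤1+b = quot-unique (Monic-resp (sym (∏-cyclotomic s b p^s≤1+b)) (Monic-denominator s)) {h = Ψ s} product
    where
    E = ∏ (map (cyclotomic b) (properDivisors (p ^ s)))

    product : X^ (p ^ s) - X^ 0 ≋ Ψ s * E
    product = begin
      X^ (p ^ s) - X^ 0    ≈⟨ denominator-*-Ψ s ⟨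
      denominator s * Ψ s  ≈⟨ *-congʳ (∏-cyclotomic s b p^s≤1+b) ⟨
      E * Ψ s              ≈⟨ *-comm E (Ψ s) ⟩
      Ψ s * E              ∎

  -- The only candidate below 1 is 0, which does not divide 1, so the product is empty.
  ∏-cyclotomic zero    b _ = refl
  ∏-cyclotomic (suc s) b p^1+s≤1+b rewrite properDivisors-p^1+n s = begin
    ∏ (map (cyclotomic b) (properDivisors (p ^ s) ∷ʳ p ^ s))
      ≡⟨ ≡.cong ∏ (map-++ (cyclotomic b) (properDivisors (p ^ s)) [ p ^ s ]) ⟩
    ∏ (map (cyclotomic b) (properDivisors (p ^ s)) ++ [ cyclotomic b (p ^ s) ])
      ≈⟨ ∏-++ (map (cyclotomic b) (properDivisors (p ^ s))) [ cyclotomic b (p ^ s) ] ⟩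
    ∏ (map (cyclotomic b) (properDivisors (p ^ s))) * (cyclotomic b (p ^ s) * const 1ℤ)
      ≈⟨ *-cong (∏-cyclotomic s b (ℕ.m≤n⇒m≤1+n p^s≤b)) (trans (*-identityʳ _) (cyclotomic≋Ψ s b p^s≤b)) ⟩
    denominator s * Ψ s
      ≈⟨ denominator-*-Ψ s ⟩
    X^ (p ^ s) - X^ 0 ∎
    where
    p^s≤b : p ^ s ≤ b
    p^s≤b = ℕ.≤-pred (ℕ.<-≤-trans (p^n<p^1+n s) p^1+s≤1+b)

-- Modular arithmetic and the coefficient sequence.

bézout-% : ∀ d M .{{_ : NonZero M}} → ∃[ a ] (a ℕ.* d) % M ≡ gcd d M % M
bézout-% d M with Bézout.identity (gcd-GCD d M)
... | Bézout.+- x y eq = x , ≡.trans (≡.cong (_% M) (≡.sym eq)) ([m+kn]%n≡m%n (gcd d M) y M)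
-- Here gcd + x d = y M, so the required coefficient is -x, represented modulo `M` by x (M - 1).
bézout-% d M@(suc M′) | Bézout.-+ x y eq = x ℕ.* M′ , (begin
  (x ℕ.* M′ ℕ.* d) % M                             ≡⟨ [m+kn]%n≡m%n (x ℕ.* M′ ℕ.* d) y M ⟨
  (x ℕ.* M′ ℕ.* d ℕ.+ y ℕ.* M) % M                 ≡⟨ ≡.cong (λ z → (x ℕ.* M′ ℕ.* d ℕ.+ z) % M) eq ⟨
  (x ℕ.* M′ ℕ.* d ℕ.+ (gcd d M ℕ.+ x ℕ.* d)) % M   ≡⟨ ≡.cong (_% M) (regroup x M′ d (gcd d M)) ⟩
  (gcd d M ℕ.+ x ℕ.* d ℕ.* M) % M                  ≡⟨ [m+kn]%n≡m%n (gcd d M) (x ℕ.* d) M ⟩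
  gcd d M % M                                      ∎)
  where
  open ≡.≡-Reasoning
  regroup : ∀ x m d g → x ℕ.* m ℕ.* d ℕ.+ (g ℕ.+ x ℕ.* d) ≡ g ℕ.+ x ℕ.* d ℕ.* suc m
  regroup = solve-∀

⟦_∣_⟧ : ℕ → ℕ → ℕ
⟦ m ∣ n ⟧ = if does (m ∣? n) then 1 else 0

⟦∣⟧-yes : ∀ {m n} → m ∣ n → ⟦ m ∣ n ⟧ ≡ 1
⟦∣⟧-yes {m} {n} m∣n = ≡.cong (if_then 1 else 0) (dec-true (m ∣? n) m∣n)

⟦∣⟧-no : ∀ {m n} → ¬ m ∣ n → ⟦ m ∣ n ⟧ ≡ 0
⟦∣⟧-no {m} {n} m∤n = ≡.cong (if_then 1 else 0) (dec-false (m ∣? n) m∤n)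

⟦∣⟧-cong : ∀ {k l m n} → (k ∣ l) ⇔ (m ∣ n) → ⟦ k ∣ l ⟧ ≡ ⟦ m ∣ n ⟧
⟦∣⟧-cong {k} {l} {m} {n} eqv = ≡.cong (if_then 1 else 0) (does-⇔ eqv (k ∣? l) (m ∣? n))

∣-+-⇔ : ∀ {k m} → k ∣ m → ∀ n → (k ∣ m ℕ.+ n) ⇔ (k ∣ n)
∣-+-⇔ k∣m n = mk⇔ (λ k∣m+n → ∣m+n∣m⇒∣n k∣m+n k∣m) (∣m∣n⇒∣m+n k∣m)

∣∣<⇒+≤ : ∀ {g m n} → g ∣ m → g ∣ n → m < n → g ℕ.+ m ≤ n
∣∣<⇒+≤ {g} (divides-refl x) (divides-refl y) xg<yg = ℕ.*-monoˡ-≤ g (ℕ.*-cancelʳ-< g x y xg<yg)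

-- Since `g` divides `v` and `q`, the remainder of `v` is at least `g` below `q`. Adding `g`
-- therefore reaches at most the next multiple of `q`, and the quotient grows exactly when it is
-- reached.
/-+-divisor : ∀ {g v q} .{{_ : NonZero q}} → 0 < g → g ∣ v → g ∣ q →
  v / q ℕ.+ ⟦ q ∣ g ℕ.+ v ⟧ ≡ (g ℕ.+ v) / q
/-+-divisor {g} {v} {q} 0<g g∣v g∣q = helper (ℕ.m≤n⇒m<n∨m≡n (∣∣<⇒+≤ g∣t g∣q (m%n<n v q)))
  where
  open ≡.≡-Reasoning
  t = v % q
  k = v / q

  g∣t : g ∣ t
  g∣t = %-presˡ-∣ g∣v g∣q

  g+v≡ : g ℕ.+ v ≡ (g ℕ.+ t) ℕ.+ k ℕ.* q
  g+v≡ = ≡.trans (≡.cong (g ℕ.+_) (m≡m%n+[m/n]*n v q)) (≡.sym (ℕ.+-assoc g t _))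

  helper : _ → k ℕ.+ ⟦ q ∣ g ℕ.+ v ⟧ ≡ (g ℕ.+ v) / q
  helper (inj₁ g+t<q) = begin
    k ℕ.+ ⟦ q ∣ g ℕ.+ v ⟧              ≡⟨ ≡.cong (k ℕ.+_) (⟦∣⟧-no q∤g+v) ⟩
    k ℕ.+ 0                            ≡⟨ ℕ.+-identityʳ k ⟩
    k                                  ≡⟨ m*n/n≡m k q ⟨
    k ℕ.* q / q                        ≡⟨ ≡.cong (ℕ._+ k ℕ.* q / q) (m<n⇒m/n≡0 g+t<q) ⟨
    (g ℕ.+ t) / q ℕ.+ k ℕ.* q / q      ≡⟨ +-distrib-/-∣ʳ (g ℕ.+ t) (n∣m*n k) ⟨
    ((g ℕ.+ t) ℕ.+ k ℕ.* q) / q        ≡⟨ ≡.cong (_/ q) g+v≡ ⟨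
    (g ℕ.+ v) / q                      ∎
    where
    q∤g+v : ¬ q ∣ g ℕ.+ v
    q∤g+v q∣g+v = ℕ.<⇒≱ g+t<q (∣⇒≤ {{ℕ.>-nonZero (ℕ.<-≤-trans 0<g (ℕ.m≤m+n g t))}}
      (∣m+n∣m⇒∣n (≡.subst (q ∣_) (≡.trans g+v≡ (ℕ.+-comm (g ℕ.+ t) _)) q∣g+v) (n∣m*n k)))
  helper (inj₂ g+t≡q) = begin
    k ℕ.+ ⟦ q ∣ g ℕ.+ v ⟧  ≡⟨ ≡.cong (k ℕ.+_) (⟦∣⟧-yes (divides (suc k) g+v≡[1+k]q)) ⟩
    k ℕ.+ 1                ≡⟨ ℕ.+-comm k 1 ⟩
    suc k                  ≡⟨ m*n/n≡m (suc k) q ⟨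
    suc k ℕ.* q / q        ≡⟨ ≡.cong (_/ q) g+v≡[1+k]q ⟨
    (g ℕ.+ v) / q          ∎
    where
    g+v≡[1+k]q : g ℕ.+ v ≡ suc k ℕ.* q
    g+v≡[1+k]q = ≡.trans g+v≡ (≡.cong (ℕ._+ k ℕ.* q) g+t≡q)

-- The quotient by `q` loses `p` exactly when `y` reaches pq and wraps to 0. At `y` = 0 the
-- indicator would be 1 without any loss, hence `0 < y`.
%-/-wrap : ∀ p q .{{_ : NonZero q}} .{{_ : NonZero (p ℕ.* q)}} {y} → 0 < y → y ≤ p ℕ.* q →
  (y % (p ℕ.* q)) / q ℕ.+ p ℕ.* ⟦ p ℕ.* q ∣ y ⟧ ≡ y / q
%-/-wrap p q {y} 0<y y≤pq with ℕ.m≤n⇒m<n∨m≡n y≤pq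
... | inj₁ y<pq = begin
  (y % (p ℕ.* q)) / q ℕ.+ p ℕ.* ⟦ p ℕ.* q ∣ y ⟧  ≡⟨ ≡.cong₂ (λ z b → z / q ℕ.+ p ℕ.* b) (m<n⇒m%n≡m y<pq) (⟦∣⟧-no λ pq∣y → ℕ.<⇒≱ y<pq (∣⇒≤ {{ℕ.>-nonZero 0<y}} pq∣y)) ⟩
  y / q ℕ.+ p ℕ.* 0                              ≡⟨ ≡.cong (y / q ℕ.+_) (ℕ.*-zeroʳ p) ⟩
  y / q ℕ.+ 0                                    ≡⟨ ℕ.+-identityʳ _ ⟩
  y / q                                          ∎
  where open ≡.≡-Reasoning
... | inj₂ ≡.refl = begin
  (p ℕ.* q % (p ℕ.* q)) / q ℕ.+ p ℕ.* ⟦ p ℕ.* q ∣ p ℕ.* q ⟧  ≡⟨ ≡.cong₂ (λ z b → z / q ℕ.+ p ℕ.* b) (n%n≡0 (p ℕ.* q)) (⟦∣⟧-yes (∣-refl {p ℕ.* q})) ⟩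
  0 / q ℕ.+ p ℕ.* 1                                          ≡⟨ ≡.cong₂ ℕ._+_ (0/n≡0 q) (ℕ.*-identityʳ p) ⟩
  p                                                          ≡⟨ m*n/n≡m p q ⟨
  p ℕ.* q / q                                                ∎
  where open ≡.≡-Reasoning

-- The coefficients of p / (x^d - 1) in the group ring of ℤ/pq modulo the
-- q-periodic sequences. They are supported on the subgroup generated by d, that
-- is, on the multiples of g = gcd d M; along that subgroup r ↦ r a % M recovers
-- g times the discrete logarithm of r to the base d.
module Coefficients (p q d : ℕ) .{{_ : NonZero p}} .{{_ : NonZero q}}
                    (0<d : 0 < d) (d<pq : d < p ℕ.* q) (g∣q : gcd d (p ℕ.* q) ∣ q) where

  M g : ℕ
  M = p ℕ.* q
  g = gcd d M

  private instance
    M-nonZero : NonZero M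
    M-nonZero = ℕ.m*n≢0 p q

  g∣d : g ∣ d
  g∣d = gcd[m,n]∣m d M

  q∣M : q ∣ M
  q∣M = n∣m*n p

  g∣M : g ∣ M
  g∣M = ∣-trans g∣q q∣M

  0<g : 0 < g
  0<g = ℕ.n≢0⇒n>0 λ g≡0 → ℕ.<⇒≢ 0<d (≡.sym (0∣⇒≡0 (≡.subst (_∣ d) g≡0 g∣d)))

  g<M : g < M
  g<M = ℕ.≤-<-trans (∣⇒≤ {{ℕ.>-nonZero 0<d}} g∣d) d<pq

  private
    bézout = bézout-% d M

  a : ℕ
  a = proj₁ bézout

  ad%M≡g : (a ℕ.* d) % M ≡ g
  ad%M≡g = ≡.trans (proj₂ bézout) (m<n⇒m%n≡m g<M)

  c : ℕ → ℕ
  c r = if does (g ∣? r) then ((r ℕ.* a) % M) / q else 0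

  c-∣ : ∀ {r} → g ∣ r → c r ≡ ((r ℕ.* a) % M) / q
  c-∣ {r} g∣r = ≡.cong (λ b → if b then ((r ℕ.* a) % M) / q else 0) (dec-true (g ∣? r) g∣r)

  c-∤ : ∀ {r} → ¬ g ∣ r → c r ≡ 0
  c-∤ {r} g∤r = ≡.cong (λ b → if b then ((r ℕ.* a) % M) / q else 0) (dec-false (g ∣? r) g∤r)

  c<p : ∀ r → c r < p
  c<p r with g ∣? r
  ... | yes g∣r = m<n*o⇒m/o<n (m%n<n (r ℕ.* a) M)
  ... | no  g∤r = ℕ.>-nonZero⁻¹ p

  c-periodic : ∀ r → c (M ℕ.+ r) ≡ c r
  c-periodic r = ≡.cong₂ (λ b z → if b then z / q else 0)
    (does-⇔ (∣-+-⇔ g∣M r) (g ∣? (M ℕ.+ r)) (g ∣? r)) (begin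
      ((M ℕ.+ r) ℕ.* a) % M       ≡⟨ ≡.cong (_% M) (regroup M r a) ⟩
      (r ℕ.* a ℕ.+ a ℕ.* M) % M   ≡⟨ [m+kn]%n≡m%n (r ℕ.* a) a M ⟩
      (r ℕ.* a) % M               ∎)
    where
    open ≡.≡-Reasoning
    regroup : ∀ M r a → (M ℕ.+ r) ℕ.* a ≡ r ℕ.* a ℕ.+ a ℕ.* M
    regroup = solve-∀

  -- a is a unit modulo M / g.
  ∣-*a-⇔ : ∀ {n r} → n ∣ M → g ∣ r → (n ∣ (r ℕ.* a) % M) ⇔ (n ∣ r)
  ∣-*a-⇔ {n} {r} n∣M g∣r@(divides r′ r≡r′g) = mk⇔ to (λ n∣r → %-presˡ-∣ (∣m⇒∣m*n a n∣r) n∣M)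
    where
    open ≡.≡-Reasoning
    k = (a ℕ.* d) / M
    d′ = quotient g∣d

    regroup₁ : ∀ r′ g a d′ → r′ ℕ.* g ℕ.* a ℕ.* d′ ≡ r′ ℕ.* (a ℕ.* (d′ ℕ.* g))
    regroup₁ = solve-∀
    regroup₂ : ∀ r′ g k M → r′ ℕ.* (g ℕ.+ k ℕ.* M) ≡ r′ ℕ.* k ℕ.* M ℕ.+ r′ ℕ.* g
    regroup₂ = solve-∀

    -- Multiplication by d / g undoes multiplication by `a` modulo `M`, because a d ≡ g and `r` is a
    -- multiple of `g`.
    eq : r ℕ.* a ℕ.* d′ ≡ r′ ℕ.* k ℕ.* M ℕ.+ r
    eq = begin
      r ℕ.* a ℕ.* d′                       ≡⟨ ≡.cong (λ z → z ℕ.* a ℕ.* d′) r≡r′g ⟩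
      r′ ℕ.* g ℕ.* a ℕ.* d′                ≡⟨ regroup₁ r′ g a d′ ⟩
      r′ ℕ.* (a ℕ.* (d′ ℕ.* g))            ≡⟨ ≡.cong (λ z → r′ ℕ.* (a ℕ.* z)) (_∣_.equality g∣d) ⟨
      r′ ℕ.* (a ℕ.* d)                     ≡⟨ ≡.cong (r′ ℕ.*_) (m≡m%n+[m/n]*n (a ℕ.* d) M) ⟩
      r′ ℕ.* ((a ℕ.* d) % M ℕ.+ k ℕ.* M)   ≡⟨ ≡.cong (λ z → r′ ℕ.* (z ℕ.+ k ℕ.* M)) ad%M≡g ⟩
      r′ ℕ.* (g ℕ.+ k ℕ.* M)               ≡⟨ regroup₂ r′ g k M ⟩
      r′ ℕ.* k ℕ.* M ℕ.+ r′ ℕ.* g          ≡⟨ ≡.cong (r′ ℕ.* k ℕ.* M ℕ.+_) r≡r′g ⟨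
      r′ ℕ.* k ℕ.* M ℕ.+ r                 ∎

    to : n ∣ (r ℕ.* a) % M → n ∣ r
    to n∣ra%M = ∣m+n∣m⇒∣n (≡.subst (n ∣_) eq (∣m⇒∣m*n d′ (∣n∣m%n⇒∣m n∣M n∣ra%M))) (∣n⇒∣m*n (r′ ℕ.* k) n∣M)

  -- On multiples of `g`, advancing the index by `d` adds `g` to r a mod M, as a d ≡ g. The quotient
  -- by `q` then gains 1 at multiples of `q` and loses `p` on wrapping at `M`. Elsewhere all four
  -- terms vanish.
  c-step : ∀ r → c r ℕ.+ ⟦ q ∣ d ℕ.+ r ⟧ ≡ c (d ℕ.+ r) ℕ.+ p ℕ.* ⟦ M ∣ d ℕ.+ r ⟧
  c-step r with g ∣? (d ℕ.+ r)
  ... | no g∤d+r = begin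
    c r ℕ.+ ⟦ q ∣ d ℕ.+ r ⟧   ≡⟨ ≡.cong₂ ℕ._+_ (c-∤ λ g∣r → g∤d+r (∣m∣n⇒∣m+n g∣d g∣r)) (⟦∣⟧-no λ q∣d+r → g∤d+r (∣-trans g∣q q∣d+r)) ⟩
    0                         ≡⟨ ℕ.*-zeroʳ p ⟨
    p ℕ.* 0                   ≡⟨ ≡.cong (p ℕ.*_) (⟦∣⟧-no λ M∣d+r → g∤d+r (∣-trans g∣M M∣d+r)) ⟨
    p ℕ.* ⟦ M ∣ d ℕ.+ r ⟧     ∎
    where open ≡.≡-Reasoning
  ... | yes g∣d+r = begin
    c r ℕ.+ ⟦ q ∣ d ℕ.+ r ⟧                          ≡⟨ ≡.cong₂ ℕ._+_ (c-∣ g∣r) (≡.sym (⟦∣⟧-cong (divides-shift q∣M))) ⟩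
    v / q ℕ.+ ⟦ q ∣ g ℕ.+ v ⟧                        ≡⟨ /-+-divisor 0<g g∣v g∣q ⟩
    (g ℕ.+ v) / q                                    ≡⟨ %-/-wrap p q (ℕ.<-≤-trans 0<g (ℕ.m≤m+n g v)) g+v≤M ⟨
    ((g ℕ.+ v) % M) / q ℕ.+ p ℕ.* ⟦ M ∣ g ℕ.+ v ⟧    ≡⟨ ≡.cong₂ (λ z b → z / q ℕ.+ p ℕ.* b) shifted (⟦∣⟧-cong (divides-shift ∣-refl)) ⟩
    (((d ℕ.+ r) ℕ.* a) % M) / q ℕ.+ p ℕ.* ⟦ M ∣ d ℕ.+ r ⟧ ∎
    where
    open ≡.≡-Reasoning
    v = (r ℕ.* a) % M

    g∣r : g ∣ r
    g∣r = ∣m+n∣m⇒∣n g∣d+r g∣d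

    g∣v : g ∣ v
    g∣v = %-presˡ-∣ (∣m⇒∣m*n a g∣r) g∣M

    g+v≤M : g ℕ.+ v ≤ M
    g+v≤M = ∣∣<⇒+≤ g∣v g∣M (m%n<n (r ℕ.* a) M)

    shifted : (g ℕ.+ v) % M ≡ ((d ℕ.+ r) ℕ.* a) % M
    shifted = begin
      (g ℕ.+ v) % M                        ≡⟨ ≡.cong (λ z → (z ℕ.+ v) % M) ad%M≡g ⟨
      ((a ℕ.* d) % M ℕ.+ v) % M            ≡⟨ %-distribˡ-+ (a ℕ.* d) (r ℕ.* a) M ⟨
      (a ℕ.* d ℕ.+ r ℕ.* a) % M            ≡⟨ ≡.cong (_% M) (regroup a d r) ⟩
      ((d ℕ.+ r) ℕ.* a) % M                ∎
      where
      regroup : ∀ a d r → a ℕ.* d ℕ.+ r ℕ.* a ≡ (d ℕ.+ r) ℕ.* a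
      regroup = solve-∀

    -- Both sides are compared with (d + r) a mod M, through `shifted` and `∣-*a-⇔`.
    divides-shift : ∀ {n} → n ∣ M → (n ∣ g ℕ.+ v) ⇔ (n ∣ d ℕ.+ r)
    divides-shift {n} n∣M = mk⇔
      (λ n∣g+v → Equivalence.to eqv (≡.subst (n ∣_) shifted (%-presˡ-∣ n∣g+v n∣M)))
      (λ n∣d+r → ∣n∣m%n⇒∣m n∣M (≡.subst (n ∣_) (≡.sym shifted) (Equivalence.from eqv n∣d+r)))
      where eqv = ∣-*a-⇔ n∣M g∣d+r

-- Coefficient lists as sums of powers.

module ApplyUpTo where
  open CommutativeRing commutativeRing using (setoid; refl; +-cong; +-congˡ; *-identityˡ; *-identityʳ)
  open Sums commutativeRing
  open Powers X^_ refl X^-+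
  open Division
  open SetoidReasoning setoid

  -- The list form gives degree and coefficient bounds directly; the sum form is what the identities
  -- on `∑pow` apply to.
  applyUpTo≋∑pow : ∀ v n → applyUpTo v n ≋ ∑pow n (λ r → const (v r))
  applyUpTo≋∑pow v zero    = refl
  applyUpTo≋∑pow v (suc n) = begin
    v 0 ∷ applyUpTo v′ n                                    ≈⟨ ∷-cong (≡.sym (ℤ.+-identityʳ (v 0))) (applyUpTo≋∑pow v′ n) ⟩
    const (v 0) + (0ℤ ∷ ∑pow n w′)                          ≈⟨ +-cong (*-identityʳ (const (v 0))) (∷-cong ≡.refl (*-identityˡ _)) ⟨
    const (v 0) * X^ 0 + (0ℤ ∷ const 1ℤ * ∑pow n w′)        ≈⟨ +-congˡ {const (v 0) * X^ 0} (0∷-* (const 1ℤ) _) ⟨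
    const (v 0) * X^ 0 + X^ 1 * ∑pow n w′                   ≈⟨ +-congˡ {const (v 0) * X^ 0} (pow*∑pow 1 n w′) ⟩
    const (v 0) * X^ 0 + ∑ n (λ r → w′ r * X^ (suc r))      ≈⟨ ∑-suc n ⟨
    ∑pow (suc n) (λ r → const (v r))                        ∎
    where
    v′ : ℕ → ℤ
    v′ r = v (suc r)
    w′ : ℕ → Poly
    w′ r = const (v′ r)

  Below-applyUpTo : ∀ v n → Below n (applyUpTo v n)
  Below-applyUpTo v zero    k       _         = ≡.refl
  Below-applyUpTo v (suc n) (suc k) (s≤s n≤k) = Below-applyUpTo (λ r → v (suc r)) n k n≤k

  coeff-applyUpTo-bound : ∀ {b} v n → (∀ r → ∣ v r ∣ ≤ b) → ∀ k → ∣ coeff (applyUpTo v n) k ∣ ≤ b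
  coeff-applyUpTo-bound v zero    v≤b k       = z≤n
  coeff-applyUpTo-bound v (suc n) v≤b zero    = v≤b 0
  coeff-applyUpTo-bound v (suc n) v≤b (suc k) = coeff-applyUpTo-bound (λ r → v (suc r)) n (λ r → v≤b (suc r)) k

-- The bounded multiplier modulo Φ.

module Inverse (p′ s d j : ℕ) (p-prime : Prime (suc p′))
               (0<d : 0 < d) (d<p^1+s : d < suc p′ ^ suc s) where
  open PrimePower p-prime
  open Cyclotomic p-prime using (Ψ; cyclotomic≋Ψ)
  open Division
  open MonicPolynomials using (Monic-∑X^)
  open ApplyUpTo

  p q : ℕ
  p = suc p′
  q = p ^ s

  instance
    q-nonZero : NonZero q
    q-nonZero = p^-nonZero s

  -- A divisor of `p ^ suc s` is the whole power or divides `q`; the whole power cannot divide the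
  -- smaller positive `d`.
  gcd∣q : gcd d (p ℕ.* q) ∣ q
  gcd∣q with ∣p^1+n⇒≡∨∣p^n s (gcd[m,n]∣n d (p ℕ.* q))
  ... | inj₁ g≡M = contradiction (∣⇒≤ ⦃ ℕ.>-nonZero 0<d ⦄ (≡.subst (_∣ d) g≡M (gcd[m,n]∣m d (p ℕ.* q)))) (ℕ.<⇒≱ d<p^1+s)
  ... | inj₂ g∣q = g∣q

  open Coefficients p q d 0<d d<p^1+s gcd∣q

  -- The index p′ q + r % q is the one congruent to `r` modulo `q` in the top block [p′ q, p q).
  h : ℕ → ℕ
  h r = c (j ℕ.+ (p′ ℕ.* q ℕ.+ r % q))

  v : ℕ → ℤ
  v r = + c (j ℕ.+ r) ℤ.- + h r

  inverse : Poly
  inverse = applyUpTo v (p′ ℕ.* q)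

  Φ≋Ψ : Φ (p ^ suc s) ≋ Ψ (suc s)
  Φ≋Ψ = cyclotomic≋Ψ (suc s) (p ^ suc s) ℕ.≤-refl

  -- A difference of naturals is at most their maximum in absolute value, so the bound `p′` on `c`
  -- survives the subtraction.
  v-bound : ∀ r → ∣ v r ∣ ≤ p′
  v-bound r = begin
    ∣ + c (j ℕ.+ r) ℤ.- + h r ∣  ≡⟨ ≡.cong ∣_∣ (ℤ.m-n≡m⊖n (c (j ℕ.+ r)) (h r)) ⟩
    ∣ c (j ℕ.+ r) ℤ.⊖ h r ∣      ≤⟨ ℤ.∣m⊝n∣≤m⊔n (c (j ℕ.+ r)) (h r) ⟩
    c (j ℕ.+ r) ℕ.⊔ h r          ≤⟨ ℕ.⊔-lub (ℕ.≤-pred (c<p (j ℕ.+ r))) (ℕ.≤-pred (c<p (j ℕ.+ (p′ ℕ.* q ℕ.+ r % q)))) ⟩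
    p′                           ∎
    where open ℕ.≤-Reasoning

  -- `inverse` has degree below p′ q, the degree of Φ, so it is its own remainder.
  norm-bound : ‖ inverse ‖∞[ p ^ suc s ] ≤ p′
  norm-bound = coeff-bound⇒max-bound (inverse rem Φ (p ^ suc s)) λ k →
    ≡.subst (λ a → ∣ a ∣ ≤ p′) (≡.sym (coeffs reduced k)) (coeff-applyUpTo-bound v (p′ ℕ.* q) v-bound k)
    where
    Φ-monic : Monic (p′ ℕ.* q) (Φ (p ^ suc s))
    Φ-monic = Monic-resp (PolynomialRing.sym Φ≋Ψ) (Monic-∑X^ p′ q (ℕ.>-nonZero⁻¹ q))

    reduced : inverse rem Φ (p ^ suc s) ≋ inverse
    reduced = rem-Below Φ-monic (Below-applyUpTo v (p′ ℕ.* q))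

  κ : ℕ → Poly
  κ n = const (+ n)

  -- Phrased with `RawSum.∑`, so that it is proved in ℤ[x] and then used unchanged in the quotient.
  inverse≋∑pow : inverse ≋ RawSum.∑ _+_ [] (p ℕ.* q) (λ r → (κ (c (j ℕ.+ r)) - κ (h r)) * X^ r)
  inverse≋∑pow = begin
    inverse
      ≈⟨ applyUpTo≋∑pow v (p′ ℕ.* q) ⟩
    ∑pow (p′ ℕ.* q) (λ r → const (v r))
      ≈⟨ ∑-cong (p′ ℕ.* q) (λ r _ → *-congʳ {X^ r} {const (v r)} {w r} (∷-cong (≡.cong (λ z → + c (j ℕ.+ r) ℤ.+ z) (≡.sym (ℤ.-1*i≡-i (+ h r)))) (refl {[]}))) ⟩
    ∑pow (p′ ℕ.* q) w
      ≈⟨ +-identityʳ _ ⟨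
    ∑pow (p′ ℕ.* q) w + []
      ≈⟨ +-congˡ {∑pow (p′ ℕ.* q) w} (∑-zero q top) ⟨
    ∑pow (p′ ℕ.* q) w + ∑ q (λ r → w (p′ ℕ.* q ℕ.+ r) * X^ (p′ ℕ.* q ℕ.+ r))
      ≈⟨ ∑-split (p′ ℕ.* q) q ⟨
    ∑pow (p′ ℕ.* q ℕ.+ q) w
      ≡⟨ ≡.cong (λ n → ∑pow n w) (ℕ.+-comm (p′ ℕ.* q) q) ⟩
    ∑pow (p ℕ.* q) w ∎
    where
    open CommutativeRing commutativeRing using (setoid; refl; +-congˡ; +-identityʳ; *-congʳ; -‿inverseʳ)
    open Sums commutativeRing
    open Powers X^_ refl X^-+
    open SetoidReasoning setoid
    w : ℕ → Poly
    w r = κ (c (j ℕ.+ r)) - κ (h r)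

    -- In the top block `h` agrees with the shifted `c`, so the sum extends to a full period.
    top : ∀ r → r < q → w (p′ ℕ.* q ℕ.+ r) * X^ (p′ ℕ.* q ℕ.+ r) ≋ []
    top r r<q = begin
      w n * X^ n                                    ≡⟨ ≡.cong (λ t → (κ (c (j ℕ.+ n)) - κ (c (j ℕ.+ (p′ ℕ.* q ℕ.+ t)))) * X^ n) n%q≡r ⟩
      (κ (c (j ℕ.+ n)) - κ (c (j ℕ.+ n))) * X^ n    ≈⟨ *-congʳ (-‿inverseʳ (κ (c (j ℕ.+ n)))) ⟩
      []                                            ∎
      where
      n = p′ ℕ.* q ℕ.+ r
      n%q≡r : n % q ≡ r
      n%q≡r = ≡.trans (≡.cong (_% q) (ℕ.+-comm (p′ ℕ.* q) r)) (≡.trans ([m+kn]%n≡m%n r p′ q) (m<n⇒m%n≡m r<q))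

  open Quotient commutativeRing (Φ (p ^ suc s)) using (_∼_; by; ≈⇒∼; quotientRing)

  -- `difference-inverse` is applied with `w` the indicator of the multiples of `q` and `δ` equal to
  -- `p` times that of the multiples of `M`.
  multiple : (X^ (j ℕ.+ d) - X^ j) * inverse ∼ κ p
  multiple = begin
    (X^ (j ℕ.+ d) - X^ j) * inverse
      ≈⟨ *-congˡ {X^ (j ℕ.+ d) - X^ j} (≈⇒∼ inverse≋∑pow) ⟩
    (X^ (j ℕ.+ d) - X^ j) * ∑pow (p ℕ.* q) (λ r → κ (c (j ℕ.+ r)) - κ (h r))
      ≈⟨ difference-inverse d j {λ r → κ (c r)} {λ r → κ ⟦ q ∣ r ⟧} {λ r → κ (h r)} {δ}
           (λ r → κ-cong (c-periodic r))
           (λ r → κ-cong (≡.cong (p ℕ.*_) (⟦∣⟧-cong (∣-+-⇔ (∣-refl {M}) r))))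
           (λ r → κ-cong (⟦∣⟧-cong (∣-+-⇔ (∣-refl {q}) r)))
           (λ r → κ-cong (≡.cong (λ t → c (j ℕ.+ (p′ ℕ.* q ℕ.+ t))) (≡.trans (≡.cong (_% q) (ℕ.+-comm q r)) ([m+n]%n≡m%n r q))))
           -- `κ m + κ n` computes to `κ (m ℕ.+ n)`, so the recurrence in ℕ lifts directly.
           (λ r → κ-cong (c-step r)) ⟩
    ∑pow (p ℕ.* q) δ
      -- In the range 0 ≤ r < M only 0 is a multiple of `M`.
      ≈⟨ ∑-head (p ℕ.* q) (ℕ.m^n>0 p (suc s)) (λ r 0<r r<M →
           ≈⇒∼ (PolynomialRing.trans (R.*-congʳ {X^ r} {δ r} {[]} (κ≡0 (vanish r 0<r r<M))) (R.zeroˡ (X^ r)))) ⟩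
    δ 0 * X^ 0
      ≈⟨ ≈⇒∼ (R.*-identityʳ (δ 0)) ⟩
    δ 0
      ≈⟨ κ-cong (≡.trans (≡.cong (p ℕ.*_) (⟦∣⟧-yes (M ∣0))) (ℕ.*-identityʳ p)) ⟩
    κ p ∎
    where
    module R = CommutativeRing commutativeRing
    open CommutativeRing quotientRing using (setoid; *-congˡ)
    open SetoidReasoning setoid
    open Sums quotientRing
    open Powers X^_ (≈⇒∼ R.refl) (λ m n → ≈⇒∼ (X^-+ m n))
    -- The geometric sum is `Ψ (suc s)`, equal to Φ, hence zero in the quotient with multiplier 1.
    open Root q p (by (const 1ℤ) (R.trans (R.+-identityʳ _) (R.trans (R.sym Φ≋Ψ) (R.sym (R.*-identityˡ _)))))

    δ : ℕ → Poly
    δ r = κ (p ℕ.* ⟦ M ∣ r ⟧)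

    κ-cong : ∀ {m n} → m ≡ n → κ m ∼ κ n
    κ-cong ≡.refl = ≈⇒∼ R.refl

    κ≡0 : ∀ {n} → n ≡ 0 → κ n ≋ []
    κ≡0 ≡.refl = PolynomialRing.0∷[]

    vanish : ∀ r → 0 < r → r < M → p ℕ.* ⟦ M ∣ r ⟧ ≡ 0
    vanish r 0<r r<M = ≡.trans
      (≡.cong (p ℕ.*_) (⟦∣⟧-no λ M∣r → ℕ.<⇒≱ r<M (∣⇒≤ ⦃ ℕ.>-nonZero 0<r ⦄ M∣r))) (ℕ.*-zeroʳ p)

theorem1 : ∀ (p s : ℕ) → Prime p → 1 ≤ s →
    ∀ (i j : ℕ) → j < i → i < p ^ s →
    ∃[ u ] ((X^ i - X^ j) * u ≡ const (+ p) [mod Φ (p ^ s) ]) × (‖ u ‖∞[ p ^ s ] ≤ p ∸ 1)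
theorem1 (suc p′) (suc s) p-prime _ i j j<i i<p^s
  -- Matching replaces `i` by `j + d`, and d ≤ j + d < p ^ suc s bounds `d`.
  with d , ≡.refl ← ℕ.m≤n⇒∃[o]m+o≡n (ℕ.<⇒≤ j<i) = inverse , (multiplier , coeffs difference) , norm-bound
  where
  0<d : 0 < d
  0<d = ℕ.+-cancelˡ-< j 0 d (≡.subst (_< j ℕ.+ d) (≡.sym (ℕ.+-identityʳ j)) j<i)
  open Inverse p′ s d j p-prime 0<d (ℕ.≤-<-trans (ℕ.m≤n+m d j) i<p^s)
  open Quotient._∼_ multiple
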